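{- Let $\mathbf{A}$ be an $n\times d$ matrix with rows $\mathbf{a}_1,\dots,\mathbf{a}_n$. For $i\in\{0,\dots,n\}$ let $\mathbf{A}_i$ be the matrix consisting of the first $i$ rows of $\mathbf{A}$. For $\lambda>0$, let $$l_i := \min\left(\mathbf{a}_i^T(\mathbf{A}_{i-1}^T\mathbf{A}_{i-1}+\lambda\mathbf{I})^{ -1}\mathbf{a}_i,\ 1\right)$$ be the online $\lambda$-ridge leverage score of the $i$-th row of $\mathbf{A}$. Then $$\sum_{i=1}^n l_i = O\left(d\log\left(\|\mathbf{A}\|_2^2/\lambda\right)\right).$$
   Context: Matrices are real; the rows $\mathbf{a}_i$ are regarded as column vectors in $\mathbb{R}^d$ in the formulas. $\|\mathbf{A}\|_2$ denotes the spectral norm, $\mathbf{I}$ is the $d\times d$ identity matrix, and $\mathbf{A}_0^T\mathbf{A}_0$ is the $d\times d$ zero matrix. -}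

module Defs where

open import Algebra.Bundles using (CommutativeRing)
open import Algebra.Structures using (IsCommutativeRing)
import Algebra.Construct.NaturalChoice.Min as Min
import Algebra.Properties.Monoid.Mult as Mult
import Algebra.Properties.Monoid.Sum as Sum
import Algebra.Properties.Semiring.Exp as Exp
open import Data.Bool.Base using (if_then_else_)
open import Data.Fin.Base using (Fin; toℕ; inject!; inject₁)
open import Data.Fin.Properties using (_≟_)
open import Data.Nat.Base as ℕ using (ℕ)
open import Data.Product.Base using (∃-syntax; _×_)
open import Data.Vec.Functional using (Vector)
open import Relation.Binary.Bundles using (DecTotalOrder)
open import Relation.Binary.Core using (Rel)
import Relation.Binary.Construct.NonStrictToStrict as ToStrict
open import Relation.Binary.Structures using (IsDecTotalOrder)
open import Relation.Nullary using (¬_; does)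
open import Relation.Unary using (Pred; Satisfiable)
open import Level using (0ℓ)

IsUpperBound : {A : Set} → Rel A 0ℓ → Pred A 0ℓ → A → Set
IsUpperBound _≤_ P u = ∀ x → P x → x ≤ u

IsLUB : {A : Set} → Rel A 0ℓ → Pred A 0ℓ → A → Set
IsLUB _≤_ P s = IsUpperBound _≤_ P s × (∀ u → IsUpperBound _≤_ P u → s ≤ u)

-- The real numbers, given axiomatically: classically, any two complete ordered
-- fields are isomorphic.  The order is decidable, as in classical mathematics.
-- The operations _⁻¹ and sup are total, but nothing is assumed about 0# ⁻¹, nor
-- about sup P when P is empty or unbounded above.
record CompleteOrderedField : Set₁ where
  infix  8 _⁻¹
  infix  8 -_
  infixl 7 _*_
  infixl 6 _+_
  infix  4 _≈_ _≤_
  field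
    Carrier           : Set
    _≈_ _≤_           : Rel Carrier 0ℓ
    _+_ _*_           : Carrier → Carrier → Carrier
    -_                : Carrier → Carrier
    0# 1#             : Carrier
    _⁻¹               : Carrier → Carrier
    sup               : Pred Carrier 0ℓ → Carrier
    isCommutativeRing : IsCommutativeRing _≈_ _+_ _*_ -_ 0# 1#
    isDecTotalOrder   : IsDecTotalOrder _≈_ _≤_
    0≉1               : ¬ 0# ≈ 1#
    *-inverseʳ        : ∀ x → ¬ x ≈ 0# → x * x ⁻¹ ≈ 1#
    +-monoˡ-≤         : ∀ z {x y} → x ≤ y → x + z ≤ y + z
    *-nonNegative     : ∀ {x y} → 0# ≤ x → 0# ≤ y → 0# ≤ x * y
    sup-isLUB         : ∀ P → Satisfiable P → ∃[ u ] IsUpperBound _≤_ P u →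
                        IsLUB _≤_ P (sup P)

  commutativeRing : CommutativeRing 0ℓ 0ℓ
  commutativeRing = record { isCommutativeRing = isCommutativeRing }

  decTotalOrder : DecTotalOrder 0ℓ 0ℓ 0ℓ
  decTotalOrder = record { isDecTotalOrder = isDecTotalOrder }

module Reals (R : CompleteOrderedField) where

  open CompleteOrderedField R public renaming (Carrier to ℝ)
  open CommutativeRing commutativeRing public using (+-monoid; semiring)
  open Mult +-monoid public using () renaming (_×_ to _•_)
  open Sum +-monoid public using (sum)
  open Exp semiring public using (_^_)
  open Min (DecTotalOrder.totalOrder decTotalOrder) public using (_⊓_)
  open ToStrict _≈_ _≤_ public using (_<_)

  infixl 7 _/_

  _/_ : ℝ → ℝ → ℝ
  x / y = x * y ⁻¹

  fromℕ : ℕ → ℝ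
  fromℕ n = n • 1#

  √ : ℝ → ℝ
  √ x = sup λ t → t * t ≤ x

  -- For a convergent sequence this is its limit.
  liminf : (ℕ → ℝ) → ℝ
  liminf u = sup λ z → ∃[ N ] (∀ n → N ℕ.≤ n → z ≤ u n)

  -- lim (1 + y/m)^m, with m = n + 1 to keep the denominator nonzero.
  exp : ℝ → ℝ
  exp y = liminf λ n → (1# + y / fromℕ (ℕ.suc n)) ^ ℕ.suc n

  -- The inverse of exp: exp is continuous and increasing, so for x > 0 the
  -- supremum is attained exactly where exp y ≈ x.
  log : ℝ → ℝ
  log x = sup λ y → exp y ≤ x

module Matrices (R : CompleteOrderedField) where

  open Reals R public

  Vec : ℕ → Set
  Vec d = Vector ℝ d

  Matrix : ℕ → ℕ → Set
  Matrix n d = Vector (Vec d) n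

  infixl 7 _∙_ _*ᵥ_ _*ₘ_
  infixl 6 _+ₘ_
  infix  4 _≈ₘ_

  _≈ₘ_ : ∀ {n d} → Matrix n d → Matrix n d → Set
  A ≈ₘ B = ∀ i j → A i j ≈ B i j

  _∙_ : ∀ {d} → Vec d → Vec d → ℝ
  x ∙ y = sum λ i → x i * y i

  _ᵀ : ∀ {n d} → Matrix n d → Matrix d n
  (A ᵀ) j i = A i j

  _*ᵥ_ : ∀ {n d} → Matrix n d → Vec d → Vec n
  (A *ᵥ x) i = A i ∙ x

  _*ₘ_ : ∀ {n m d} → Matrix n m → Matrix m d → Matrix n d
  (A *ₘ B) i k = A i ∙ (B ᵀ) k

  _+ₘ_ : ∀ {n d} → Matrix n d → Matrix n d → Matrix n d
  (A +ₘ B) i j = A i j + B i j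

  scale : ∀ {n d} → ℝ → Matrix n d → Matrix n d
  scale c A i j = c * A i j

  𝕀 : ∀ {d} → Matrix d d
  𝕀 i j = if does (i ≟ j) then 1# else 0#

  IsInverse : ∀ {d} → Matrix d d → Matrix d d → Set
  IsInverse M N = (M *ₘ N ≈ₘ 𝕀) × (N *ₘ M ≈ₘ 𝕀)

  -- A definite description: inverses are unique, so for invertible M each
  -- entry is the supremum of a singleton.  For singular M the set is empty and
  -- the value is unspecified.
  inverse : ∀ {d} → Matrix d d → Matrix d d
  inverse M i j = sup λ t → ∃[ N ] (IsInverse M N × t ≈ N i j)

  ∥_∥ : ∀ {d} → Vec d → ℝ
  ∥ x ∥ = √ (x ∙ x)

  -- The operator norm induced by the Euclidean norms.
  ∥_∥₂ : ∀ {n d} → Matrix n d → ℝ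
  ∥ A ∥₂ = sup λ t → ∃[ x ] (∥ x ∥ ≤ 1# × t ≈ ∥ A *ᵥ x ∥)

  firstRows : ∀ {n d} → Matrix n d → (i : Fin (ℕ.suc n)) → Matrix (toℕ i) d
  firstRows A i k = A (inject! {i = i} k)

  -- Rows are indexed from zero, so the rows preceding row i are the first
  -- toℕ i rows.
  leverage : ∀ {n d} → Matrix n d → ℝ → Fin n → ℝ
  leverage A lam i = (A i ∙ (inverse (Aᵢ ᵀ *ₘ Aᵢ +ₘ scale lam 𝕀) *ᵥ A i)) ⊓ 1#
    where Aᵢ = firstRows A (inject₁ i)

{-# OPTIONS --safe #-}

-- Every matrix that occurs is a Gram matrix plus λI, hence has positive pivots,
-- and its determinant is the product of the pivots, which are computed by
-- repeated Schur complements.  Adding a row a to a matrix M multiplies the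
-- determinant by 1 + aᵀM⁻¹a ≥ 1 + lᵢ, so Π (1 + lᵢ) ≤ det (AᵀA + λI) / λ^d.
-- Hadamard's inequality bounds the right-hand side by (1 + ρ)^d, where
-- ρ = ∥A∥₂² / λ, because the diagonal entries of AᵀA are at most ∥A∥₂².
-- Choosing k with 1 + ρ ≤ ρ^k and using (1 + l / 2N)^N ≤ 1 + l on [0, 1],
-- one gets (1 + s / m)^m ≤ ρ for all m, where s = Σ lᵢ / (2kd); that is, s ≤ log ρ.
-- The natural number k exists only up to double negation, which is harmless as
-- the order is decidable.
module Submission where

open import Algebra.Bundles using (CommutativeRing)
import Algebra.Construct.NaturalChoice.Min as Min
import Algebra.Construct.NaturalChoice.MinOp as MinOp
import Algebra.Properties.CommutativeSemiring.Exp as Exp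
import Algebra.Properties.Ring as RingProperties
import Algebra.Properties.Semiring.Mult as SemiringMult
import Algebra.Properties.Semiring.Mult.TCOptimised as SemiringMult′
import Algebra.Properties.Semiring.Sum as SemiringSum
import Algebra.Solver.Ring as Solver
open import Algebra.Solver.Ring.AlmostCommutativeRing
  using (fromCommutativeRing; _-Raw-AlmostCommutative⟶_)
open import Data.Empty using (⊥-elim)
open import Data.Fin.Base using (Fin; zero; suc; inject₁)
import Data.Integer.Base as ℤ
import Data.Integer.Properties as ℤ
open import Data.Maybe.Base using (Maybe; just; nothing)
open import Data.Nat.Base as ℕ using (ℕ; zero; suc)
import Data.Nat.Properties as ℕ
open import Data.Product.Base using (∃-syntax; _×_; _,_; proj₁; proj₂)
open import Data.Sum.Base using (inj₁; inj₂)
open import Data.Unit.Base using (⊤; tt)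
open import Data.Vec.Functional using (head; tail)
open import Defs
open import Function.Base using (_∘_)
open import Relation.Binary.Bundles using (DecTotalOrder)
import Relation.Binary.PropositionalEquality.Core as ≡
import Relation.Binary.Reasoning.PartialOrder as PartialOrderReasoning
import Relation.Binary.Reasoning.Setoid as SetoidReasoning
open import Relation.Nullary using (¬_; yes; no)
open import Relation.Nullary.Decidable using (decidable-stable)

-- As `ρ` tends to 1 its logarithm tends to 0, while the scores need not. The bound is therefore
-- uniform only over `ρ ≥ κ` for a fixed `κ > 1`, and the constant depends on `κ` like
-- `4 + 2 / (κ - 1)`. The definition of `log` by suprema offers no functional equation. Hence no
-- logarithm of a determinant or of a product is ever taken: all estimates are between natural
-- powers, and a single family of such inequalities, one for each `m`, is turned into a bound on
-- `log ρ` at the very end. The truncation of the scores at 1 is what makes the estimate of `1 + l`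
-- from below by an `N`-th power possible. Determinants are handled in the same economical way. With
-- the product of the pivots as definition, solvability, the effect of a rank-one update and
-- Hadamard's inequality are all inductions along one elimination step. In return, symmetry and
-- positive pivots are carried along as hypotheses.

-- A polynomial identity solver with integer coefficients for commutative rings.

module IntegerCoefficients {c ℓ} (K : CommutativeRing c ℓ) where

  open CommutativeRing K
  open RingProperties ring
  -- With this version of _×_, the coefficient 1 is interpreted as 1# itself.
  open SemiringMult′ semiring using (×1-homo-*; ×-homo-+) renaming (_×_ to _•_)
  open SetoidReasoning setoid

  ⟦_⟧ : ℤ.ℤ → Carrier
  ⟦ ℤ.+ n ⟧      = n • 1#
  ⟦ ℤ.-[1+ n ] ⟧ = - (suc n • 1#)

  ⟦-_⟧ : ∀ i → ⟦ ℤ.- i ⟧ ≈ - ⟦ i ⟧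
  ⟦- ℤ.+ zero ⟧    = sym -0#≈0#
  ⟦- ℤ.+ suc n ⟧   = refl
  ⟦- ℤ.-[1+ n ] ⟧  = sym (-‿involutive _)

  suc-• : ∀ n → suc n • 1# ≈ 1# + n • 1#
  suc-• n = ×-homo-+ 1# 1 n

  ⟦_⊖_⟧ : ∀ m n → ⟦ m ℤ.⊖ n ⟧ ≈ m • 1# - n • 1#
  ⟦ m     ⊖ zero  ⟧ = sym (trans (+-congˡ -0#≈0#) (+-identityʳ _))
  ⟦ zero  ⊖ suc n ⟧ = sym (+-identityˡ _)
  ⟦ suc m ⊖ suc n ⟧ = begin
    ⟦ suc m ℤ.⊖ suc n ⟧                  ≡⟨ ≡.cong ⟦_⟧ (ℤ.[1+m]⊖[1+n]≡m⊖n m n) ⟩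
    ⟦ m ℤ.⊖ n ⟧                          ≈⟨ ⟦ m ⊖ n ⟧ ⟩
    m • 1# - n • 1#                      ≈⟨ +-congʳ (+-identityʳ _) ⟨
    m • 1# + 0# - n • 1#                 ≈⟨ +-congʳ (+-congˡ (-‿inverseʳ 1#)) ⟨
    m • 1# + (1# - 1#) - n • 1#          ≈⟨ +-congʳ (+-assoc _ _ _) ⟨
    m • 1# + 1# - 1# - n • 1#            ≈⟨ +-assoc _ _ _ ⟩
    m • 1# + 1# + (- 1# - n • 1#)        ≈⟨ +-cong (+-comm _ _) (-‿+-comm _ _) ⟩
    1# + m • 1# - (1# + n • 1#)          ≈⟨ +-cong (suc-• m) (-‿cong (suc-• n)) ⟨
    suc m • 1# - suc n • 1#              ∎

  ⟦_+_⟧ : ∀ i j → ⟦ i ℤ.+ j ⟧ ≈ ⟦ i ⟧ + ⟦ j ⟧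
  ⟦ ℤ.+ m      + ℤ.+ n      ⟧ = ×-homo-+ 1# m n
  ⟦ ℤ.+ m      + ℤ.-[1+ n ] ⟧ = ⟦ m ⊖ suc n ⟧
  ⟦ ℤ.-[1+ m ] + ℤ.+ n      ⟧ = trans ⟦ n ⊖ suc m ⟧ (+-comm _ _)
  ⟦ ℤ.-[1+ m ] + ℤ.-[1+ n ] ⟧ = begin
    ⟦ ℤ.-[1+ m ] ℤ.+ ℤ.-[1+ n ] ⟧  ≡⟨ ≡.cong ⟦_⟧ (ℤ.neg-distrib-+ (ℤ.+ suc m) (ℤ.+ suc n)) ⟨
    - ((suc m ℕ.+ suc n) • 1#)     ≈⟨ -‿cong (×-homo-+ 1# (suc m) (suc n)) ⟩
    - (suc m • 1# + suc n • 1#)    ≈⟨ -‿+-comm _ _ ⟨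
    - (suc m • 1#) - suc n • 1#    ∎

  ⟦_*⁺_⟧ : ∀ m j → ⟦ ℤ.+ m ℤ.* j ⟧ ≈ m • 1# * ⟦ j ⟧
  ⟦ m *⁺ ℤ.+ n ⟧ = trans (reflexive (≡.cong ⟦_⟧ (≡.sym (ℤ.pos-* m n)))) (×1-homo-* m n)
  ⟦ m *⁺ ℤ.-[1+ n ] ⟧ = begin
    ⟦ ℤ.+ m ℤ.* ℤ.-[1+ n ] ⟧        ≡⟨ ≡.cong ⟦_⟧ (ℤ.neg-distribʳ-* (ℤ.+ m) (ℤ.+ suc n)) ⟨
    ⟦ ℤ.- (ℤ.+ m ℤ.* ℤ.+ suc n) ⟧   ≈⟨ ⟦- ℤ.+ m ℤ.* ℤ.+ suc n ⟧ ⟩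
    - ⟦ ℤ.+ m ℤ.* ℤ.+ suc n ⟧       ≈⟨ -‿cong ⟦ m *⁺ ℤ.+ suc n ⟧ ⟩
    - (m • 1# * suc n • 1#)         ≈⟨ -‿distribʳ-* _ _ ⟩
    m • 1# * - (suc n • 1#)         ∎

  ⟦_*_⟧ : ∀ i j → ⟦ i ℤ.* j ⟧ ≈ ⟦ i ⟧ * ⟦ j ⟧
  ⟦ ℤ.+ m * j ⟧ = ⟦ m *⁺ j ⟧
  ⟦ ℤ.-[1+ m ] * j ⟧ = begin
    ⟦ ℤ.-[1+ m ] ℤ.* j ⟧           ≡⟨ ≡.cong ⟦_⟧ (ℤ.neg-distribˡ-* (ℤ.+ suc m) j) ⟨
    ⟦ ℤ.- (ℤ.+ suc m ℤ.* j) ⟧      ≈⟨ ⟦- ℤ.+ suc m ℤ.* j ⟧ ⟩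
    - ⟦ ℤ.+ suc m ℤ.* j ⟧          ≈⟨ -‿cong ⟦ suc m *⁺ j ⟧ ⟩
    - (suc m • 1# * ⟦ j ⟧)         ≈⟨ -‿distribˡ-* _ _ ⟩
    - (suc m • 1#) * ⟦ j ⟧         ∎

  homomorphism : ℤ.+-*-rawRing -Raw-AlmostCommutative⟶ fromCommutativeRing K
  homomorphism = record
    { ⟦_⟧    = ⟦_⟧
    ; +-homo = ⟦_+_⟧
    ; *-homo = ⟦_*_⟧
    ; -‿homo = ⟦-_⟧
    ; 0-homo = refl
    ; 1-homo = refl
    }

  _≟?_ : ∀ i j → Maybe (⟦ i ⟧ ≈ ⟦ j ⟧)
  i ≟? j with i ℤ.≟ j
  ... | yes i≡j = just (reflexive (≡.cong ⟦_⟧ i≡j))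
  ... | no  _   = nothing

  open Solver ℤ.+-*-rawRing (fromCommutativeRing K) homomorphism _≟?_ public
    using (Polynomial; solve; con; _:+_; _:*_; _:-_; :-_; _:=_)

  :0 :1 : ∀ {n} → Polynomial n
  :0 = con (ℤ.+ 0)
  :1 = con (ℤ.+ 1)

-- Inequalities in ordered fields, natural powers, the Archimedean property, square roots.

module OrderedField (R : CompleteOrderedField) where

  open Matrices R public
  open CommutativeRing commutativeRing public
    using ( _-_; refl; sym; trans; +-cong; +-congˡ; +-congʳ; *-cong; *-congˡ; *-congʳ; -‿cong
          ; *-assoc; *-comm; +-identityˡ; +-identityʳ; *-identityˡ; *-identityʳ
          ; zeroˡ; zeroʳ; -‿inverseʳ; commutativeSemiring)
  open Exp commutativeSemiring public using (^-congˡ; ^-assocʳ; ^-distrib-*)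
  open DecTotalOrder decTotalOrder public
    using (antisym; total; _≤?_; poset)
    renaming (refl to ≤-refl; trans to ≤-trans; reflexive to ≤-reflexive)
  open IntegerCoefficients commutativeRing public
    using (solve; :0; :1; _:+_; _:*_; _:-_; :-_; _:=_)
  open PartialOrderReasoning poset

  stable : ∀ {x y} → ¬ ¬ (x ≤ y) → x ≤ y
  stable {x} {y} = decidable-stable (x ≤? y)

  ≰⇒≥ : ∀ {x y} → ¬ x ≤ y → y ≤ x
  ≰⇒≥ {x} {y} x≰y with total x y
  ... | inj₁ x≤y = ⊥-elim (x≰y x≤y)
  ... | inj₂ y≤x = y≤x

  ≰⇒> : ∀ {x y} → ¬ x ≤ y → y < x
  ≰⇒> x≰y = ≰⇒≥ x≰y , λ y≈x → x≰y (≤-reflexive (sym y≈x))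

  <⇒≱ : ∀ {x y} → x < y → ¬ y ≤ x
  <⇒≱ (x≤y , x≉y) y≤x = x≉y (antisym x≤y y≤x)

  y-x≥0 : ∀ {x y} → x ≤ y → 0# ≤ y - x
  y-x≥0 {x} {y} x≤y = begin
    0#     ≈⟨ -‿inverseʳ x ⟨
    x - x  ≤⟨ +-monoˡ-≤ (- x) x≤y ⟩
    y - x  ∎

  -- The form in which most inequalities below are proved: the difference is exhibited as a visibly
  -- nonnegative expression, and the identity is left to the solver.
  ≤-by : ∀ {x y} z → 0# ≤ z → y ≈ x + z → x ≤ y
  ≤-by {x} {y} z 0≤z y≈x+z = begin
    x       ≈⟨ +-identityˡ x ⟨
    0# + x  ≤⟨ +-monoˡ-≤ x 0≤z ⟩
    z + x   ≈⟨ solve 2 (λ x z → z :+ x := x :+ z) refl x z ⟩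
    x + z   ≈⟨ y≈x+z ⟨
    y       ∎

  +-nonNegative : ∀ {x y} → 0# ≤ x → 0# ≤ y → 0# ≤ x + y
  +-nonNegative {x} {y} 0≤x 0≤y = begin
    0#      ≤⟨ 0≤y ⟩
    y       ≈⟨ +-identityˡ y ⟨
    0# + y  ≤⟨ +-monoˡ-≤ y 0≤x ⟩
    x + y   ∎

  +-mono-≤ : ∀ {x y u v} → x ≤ y → u ≤ v → x + u ≤ y + v
  +-mono-≤ {x} {y} {u} {v} x≤y u≤v = ≤-by _ (+-nonNegative (y-x≥0 x≤y) (y-x≥0 u≤v))
    (solve 4 (λ x y u v → y :+ v := x :+ u :+ (y :- x :+ (v :- u))) refl x y u v)

  x≤x+y : ∀ x {y} → 0# ≤ y → x ≤ x + y
  x≤x+y x 0≤y = ≤-by _ 0≤y refl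

  *-monoˡ-≤ : ∀ {x y z} → 0# ≤ z → x ≤ y → z * x ≤ z * y
  *-monoˡ-≤ {x} {y} {z} 0≤z x≤y = ≤-by _ (*-nonNegative 0≤z (y-x≥0 x≤y))
    (solve 3 (λ x y z → z :* y := z :* x :+ z :* (y :- x)) refl x y z)

  *-mono-≤ : ∀ {x y u v} → 0# ≤ x → 0# ≤ v → x ≤ y → u ≤ v → x * u ≤ y * v
  *-mono-≤ {x} {y} {u} {v} 0≤x 0≤v x≤y u≤v =
    ≤-by _ (+-nonNegative (*-nonNegative 0≤x (y-x≥0 u≤v)) (*-nonNegative 0≤v (y-x≥0 x≤y)))
    (solve 4 (λ x y u v → y :* v := x :* u :+ (x :* (v :- u) :+ v :* (y :- x))) refl x y u v)

  x²-nonNegative : ∀ x → 0# ≤ x * x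
  x²-nonNegative x with total 0# x
  ... | inj₁ 0≤x = *-nonNegative 0≤x 0≤x
  ... | inj₂ x≤0 = ≤-trans (*-nonNegative (y-x≥0 x≤0) (y-x≥0 x≤0))
    (≤-reflexive (solve 1 (λ x → (:0 :- x) :* (:0 :- x) := x :* x) refl x))

  0≤1 : 0# ≤ 1#
  0≤1 = ≤-trans (x²-nonNegative 1#) (≤-reflexive (*-identityˡ 1#))

  0<1 : 0# < 1#
  0<1 = 0≤1 , 0≉1

  0≤2 : 0# ≤ 1# + 1#
  0≤2 = +-nonNegative 0≤1 0≤1

  <-≤-trans : ∀ {x y z} → x < y → y ≤ z → x < z
  <-≤-trans x<y y≤z = ≰⇒> λ z≤x → <⇒≱ x<y (≤-trans y≤z z≤x)

  +-positive : ∀ {x y} → 0# < x → 0# ≤ y → 0# < x + y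
  +-positive 0<x 0≤y = <-≤-trans 0<x (x≤x+y _ 0≤y)

  x⁻¹-nonNegative : ∀ {x} → 0# < x → 0# ≤ x ⁻¹
  x⁻¹-nonNegative {x} (0≤x , 0≉x) = stable λ ≰ → <⇒≱ 0<1 (begin
    1#        ≈⟨ *-inverseʳ x (λ x≈0 → 0≉x (sym x≈0)) ⟨
    x * x ⁻¹  ≤⟨ *-monoˡ-≤ 0≤x (≰⇒≥ ≰) ⟩
    x * 0#    ≈⟨ zeroʳ x ⟩
    0#        ∎)

  *-inverse : ∀ {x} → 0# < x → x * x ⁻¹ ≈ 1#
  *-inverse {x} (_ , 0≉x) = *-inverseʳ x λ x≈0 → 0≉x (sym x≈0)

  *-cancelˡ-≤ : ∀ {x y z} → 0# < x → x * y ≤ x * z → y ≤ z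
  *-cancelˡ-≤ {x} {y} {z} 0<x xy≤xz = begin
    y                ≈⟨ cancel y ⟨
    x ⁻¹ * (x * y)   ≤⟨ *-monoˡ-≤ (x⁻¹-nonNegative 0<x) xy≤xz ⟩
    x ⁻¹ * (x * z)   ≈⟨ cancel z ⟩
    z                ∎
    where
    cancel : ∀ w → x ⁻¹ * (x * w) ≈ w
    cancel w = begin-equality
      x ⁻¹ * (x * w)   ≈⟨ solve 3 (λ x p w → p :* (x :* w) := x :* p :* w) refl x (x ⁻¹) w ⟩
      x * x ⁻¹ * w     ≈⟨ *-congʳ (*-inverse 0<x) ⟩
      1# * w           ≈⟨ *-identityˡ w ⟩
      w                ∎

  *-cancelˡ-≈ : ∀ {x y z} → 0# < x → x * y ≈ x * z → y ≈ z
  *-cancelˡ-≈ 0<x xy≈xz =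
    antisym (*-cancelˡ-≤ 0<x (≤-reflexive xy≈xz)) (*-cancelˡ-≤ 0<x (≤-reflexive (sym xy≈xz)))

  *-monoˡ-< : ∀ {x y z} → 0# < z → x < y → z * x < z * y
  *-monoˡ-< 0<z x<y = ≰⇒> λ zy≤zx → <⇒≱ x<y (*-cancelˡ-≤ 0<z zy≤zx)

  *-positive : ∀ {x y} → 0# < x → 0# < y → 0# < x * y
  *-positive {x} {y} 0<x 0<y = begin-strict
    0#      ≈⟨ zeroʳ x ⟨
    x * 0#  <⟨ *-monoˡ-< 0<x 0<y ⟩
    x * y   ∎

  -- The axioms do not say that inversion respects `≈`; for positive arguments this follows by
  -- cancellation.
  ⁻¹-cong : ∀ {x y} → 0# < x → x ≈ y → x ⁻¹ ≈ y ⁻¹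
  ⁻¹-cong {x} {y} 0<x x≈y = *-cancelˡ-≈ 0<x (begin-equality
    x * x ⁻¹  ≈⟨ *-inverse 0<x ⟩
    1#        ≈⟨ *-inverse (<-≤-trans 0<x (≤-reflexive x≈y)) ⟨
    y * y ⁻¹  ≈⟨ *-congʳ x≈y ⟨
    x * y ⁻¹  ∎)

  ^-positive : ∀ {x} n → 0# < x → 0# < x ^ n
  ^-positive zero    0<x = 0<1
  ^-positive (suc n) 0<x = *-positive 0<x (^-positive n 0<x)

  ^-nonNegative : ∀ {x} n → 0# ≤ x → 0# ≤ x ^ n
  ^-nonNegative zero    0≤x = 0≤1
  ^-nonNegative (suc n) 0≤x = *-nonNegative 0≤x (^-nonNegative n 0≤x)

  ^-monoˡ-≤ : ∀ {x y} n → 0# ≤ x → x ≤ y → x ^ n ≤ y ^ n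
  ^-monoˡ-≤ zero    0≤x x≤y = ≤-refl
  ^-monoˡ-≤ (suc n) 0≤x x≤y =
    *-mono-≤ 0≤x (^-nonNegative n (≤-trans 0≤x x≤y)) x≤y (^-monoˡ-≤ n 0≤x x≤y)

  1^n≈1 : ∀ n → 1# ^ n ≈ 1#
  1^n≈1 zero    = refl
  1^n≈1 (suc n) = trans (*-identityˡ _) (1^n≈1 n)

  -- Takes the place of extracting roots. If `y < x`, then `x` is positive and
  -- `y * y ^ n ≤ y * x ^ n < x * x ^ n`.
  ^-cancelˡ-≤ : ∀ {x y} n → 0# ≤ y → x ^ suc n ≤ y ^ suc n → x ≤ y
  ^-cancelˡ-≤ {x} {y} n 0≤y xⁿ≤yⁿ = stable λ x≰y →
    let y<x = ≰⇒> x≰y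
        0<x = ≰⇒> λ x≤0 → x≰y (≤-trans x≤0 0≤y)
    in <⇒≱ (begin-strict
         y * y ^ n  ≤⟨ *-monoˡ-≤ 0≤y (^-monoˡ-≤ n 0≤y (proj₁ y<x)) ⟩
         y * x ^ n  ≈⟨ *-comm _ _ ⟩
         x ^ n * y  <⟨ *-monoˡ-< (^-positive n 0<x) y<x ⟩
         x ^ n * x  ≈⟨ *-comm _ _ ⟩
         x * x ^ n  ∎) xⁿ≤yⁿ

  x²-cancel-≤ : ∀ {x y} → 0# ≤ y → x * x ≤ y * y → x ≤ y
  x²-cancel-≤ {x} {y} 0≤y x²≤y² = ^-cancelˡ-≤ 1 0≤y (begin
    x * (x * 1#)  ≈⟨ *-congˡ (*-identityʳ x) ⟩
    x * x         ≤⟨ x²≤y² ⟩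
    y * y         ≈⟨ *-congˡ (*-identityʳ y) ⟨
    y * (y * 1#)  ∎)

  fromℕ-nonNegative : ∀ n → 0# ≤ fromℕ n
  fromℕ-nonNegative zero    = ≤-refl
  fromℕ-nonNegative (suc n) = +-nonNegative 0≤1 (fromℕ-nonNegative n)

  fromℕ-positive : ∀ n → 0# < fromℕ (suc n)
  fromℕ-positive n = +-positive 0<1 (fromℕ-nonNegative n)

  fromℕ-* : ∀ m n → fromℕ (m ℕ.* n) ≈ fromℕ m * fromℕ n
  fromℕ-* = SemiringMult.×1-homo-* semiring

  bernoulli : ∀ {r} n → 0# ≤ r → 1# + fromℕ n * r ≤ (1# + r) ^ n
  bernoulli {r} zero    0≤r = ≤-reflexive (solve 1 (λ r → :1 :+ :0 :* r := :1) refl r)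
  bernoulli {r} (suc n) 0≤r = begin
    1# + (1# + fromℕ n) * r
      ≤⟨ x≤x+y _ (*-nonNegative (fromℕ-nonNegative n) (*-nonNegative 0≤r 0≤r)) ⟩
    1# + (1# + fromℕ n) * r + fromℕ n * (r * r)
      ≈⟨ solve 2 (λ n r → :1 :+ (:1 :+ n) :* r :+ n :* (r :* r)
           := (:1 :+ r) :* (:1 :+ n :* r)) refl (fromℕ n) r ⟩
    (1# + r) * (1# + fromℕ n * r)
      ≤⟨ *-monoˡ-≤ (+-nonNegative 0≤1 0≤r) (bernoulli n 0≤r) ⟩
    (1# + r) * (1# + r) ^ n
      ∎

  -- The upper companion of Bernoulli's inequality, `(1 + r)^n ≤ 1 / (1 - nr)`, multiplied out so
  -- that it holds whatever the sign of `1 - nr`. The induction rests on `(1 + r)(1 - (n + 1)r) = 1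
  -- - nr - (n + 1)r²`.
  [1+r]^n*[1-nr]≤1 : ∀ {r} n → 0# ≤ r → (1# + r) ^ n * (1# - fromℕ n * r) ≤ 1#
  [1+r]^n*[1-nr]≤1 {r} zero    0≤r = ≤-reflexive
    (solve 1 (λ r → :1 :* (:1 :- :0 :* r) := :1) refl r)
  [1+r]^n*[1-nr]≤1 {r} (suc n) 0≤r = begin
    (1# + r) * p * (1# - (1# + fromℕ n) * r)
      ≤⟨ x≤x+y _ (*-nonNegative (^-nonNegative n (+-nonNegative 0≤1 0≤r))
           (*-nonNegative (fromℕ-nonNegative (suc n)) (*-nonNegative 0≤r 0≤r))) ⟩
    (1# + r) * p * (1# - (1# + fromℕ n) * r) + p * ((1# + fromℕ n) * (r * r))
      ≈⟨ solve 3 (λ n r p →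
           (:1 :+ r) :* p :* (:1 :- (:1 :+ n) :* r)
             :+ p :* ((:1 :+ n) :* (r :* r))
           := p :* (:1 :- n :* r)) refl (fromℕ n) r p ⟩
    p * (1# - fromℕ n * r)
      ≤⟨ [1+r]^n*[1-nr]≤1 n 0≤r ⟩
    1# ∎
    where p = (1# + r) ^ n

  -- If `x` bounded the naturals, their supremum `s` would satisfy `n + 1 ≤ s` for all `n`, making
  -- `s - 1` a smaller upper bound. The contradiction yields no witness, hence the double negation.
  archimedean : ∀ x → ¬ ¬ (∃[ n ] x ≤ fromℕ n)
  archimedean x unbounded = <⇒≱ 0<1 (begin
    1#               ≈⟨ solve 1 (λ s → :1 := (:- s :+ :1) :+ s) refl s ⟩
    (- s + 1#) + s          ≤⟨ +-mono-≤ ≤-refl (proj₂ lub (s - 1#) s-1-isUpperBound) ⟩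
    (- s + 1#) + (s - 1#)   ≈⟨ solve 1 (λ s → (:- s :+ :1) :+ (s :- :1) := :0) refl s ⟩
    0#               ∎)
    where
    N : ℝ → Set
    N y = ∃[ n ] y ≈ fromℕ n
    lub : IsLUB _≤_ N (sup N)
    lub = sup-isLUB N (0# , 0 , refl)
      (x , λ { y (n , y≈n) → ≤-trans (≤-reflexive y≈n) (≰⇒≥ λ x≤n → unbounded (n , x≤n)) })
    s = sup N
    s-1-isUpperBound : IsUpperBound _≤_ N (s - 1#)
    s-1-isUpperBound y (n , y≈n) = begin
      y                       ≈⟨ solve 1 (λ y → y := :1 :+ y :- :1) refl y ⟩
      1# + y - 1#             ≤⟨ +-monoˡ-≤ (- 1#) (proj₁ lub (1# + y) (suc n , +-congˡ y≈n)) ⟩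
      s - 1#                  ∎

  -- The constant of the theorem has to be fixed in advance, whereas `archimedean` provides a
  -- natural number only under a double negation. The upper bound `x + 1#` lets a known real number
  -- stand in for it.
  ceiling : ∀ {x} n → 0# ≤ x → x ≤ fromℕ n → ∃[ m ] (x ≤ fromℕ m × fromℕ m ≤ x + 1#)
  ceiling {x} zero    0≤x x≤n = 0 , x≤n , +-nonNegative 0≤x 0≤1
  ceiling {x} (suc n) 0≤x x≤n with x ≤? fromℕ n
  ... | yes x≤n′ = ceiling n 0≤x x≤n′
  ... | no  x≰n  = suc n , x≤n , (begin
    1# + fromℕ n  ≤⟨ +-mono-≤ ≤-refl (≰⇒≥ x≰n) ⟩
    1# + x        ≈⟨ solve 1 (λ x → :1 :+ x := x :+ :1) refl x ⟩
    x + 1#        ∎)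

  √-isLUB : ∀ {z} → 0# ≤ z → IsLUB _≤_ (λ t → t * t ≤ z) (√ z)
  √-isLUB {z} 0≤z = sup-isLUB _ (0# , ≤-trans (≤-reflexive (zeroˡ 0#)) 0≤z)
    (1# + z , λ t t²≤z → x²-cancel-≤ (+-nonNegative 0≤1 0≤z) (≤-trans t²≤z z≤[1+z]²))
    where
    z≤[1+z]² : z ≤ (1# + z) * (1# + z)
    z≤[1+z]² = ≤-by (1# + z + z * z) (+-nonNegative (+-nonNegative 0≤1 0≤z) (x²-nonNegative z))
      (solve 1 (λ z → (:1 :+ z) :* (:1 :+ z)
        := z :+ (:1 :+ z :+ z :* z)) refl z)

  √-nonNegative : ∀ {z} → 0# ≤ z → 0# ≤ √ z
  √-nonNegative 0≤z = proj₁ (√-isLUB 0≤z) 0# (≤-trans (≤-reflexive (zeroˡ 0#)) 0≤z)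

  √-≤ : ∀ {z u} → 0# ≤ z → 0# ≤ u → z ≤ u * u → √ z ≤ u
  √-≤ 0≤z 0≤u z≤u² = proj₂ (√-isLUB 0≤z) _ λ t t²≤z → x²-cancel-≤ 0≤u (≤-trans t²≤z z≤u²)

  -- If s = √ z had s * s < z, then a small ε > 0 would still satisfy (s + ε)² ≤ z.
  z≤√z² : ∀ {z} → 0# ≤ z → z ≤ √ z * √ z
  z≤√z² {z} 0≤z = stable λ z≰s² →
    let 0≤δ = y-x≥0 (≰⇒≥ z≰s²)
    in z≰s² (begin
      z                ≈⟨ z≈s²+cε 0≤δ ⟩
      s * s + c * ε    ≤⟨ +-mono-≤ ≤-refl (*-monoˡ-≤ (proj₁ (0<c 0≤δ)) (ε≤0 0≤δ)) ⟩
      s * s + c * 0#   ≈⟨ solve 2 (λ s c → s :* s :+ c :* :0 := s :* s) refl s c ⟩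
      s * s            ∎)
    where
    s = √ z
    δ = z - s * s
    -- In `s² + cε ≥ (s + ε)²` the summand `2s` of `c` pays for the cross term and 1 pays for `ε²`,
    -- given `ε ≤ 1`; the summand `δ` ensures that `ε = δ / c` is at most 1.
    c = 1# + (s + s + δ)
    ε = δ * c ⁻¹

    0<c : 0# ≤ δ → 0# < c
    0<c 0≤δ = +-positive 0<1
      (+-nonNegative (+-nonNegative (√-nonNegative 0≤z) (√-nonNegative 0≤z)) 0≤δ)

    cε≈δ : 0# ≤ δ → c * ε ≈ δ
    cε≈δ 0≤δ = begin-equality
      c * (δ * c ⁻¹)  ≈⟨ solve 3 (λ c d q → c :* (d :* q) := c :* q :* d) refl c δ (c ⁻¹) ⟩
      c * c ⁻¹ * δ    ≈⟨ *-congʳ (*-inverse (0<c 0≤δ)) ⟩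
      1# * δ          ≈⟨ *-identityˡ δ ⟩
      δ               ∎

    z≈s²+cε : 0# ≤ δ → z ≈ s * s + c * ε
    z≈s²+cε 0≤δ = begin-equality
      z              ≈⟨ solve 2 (λ s z → z := s :* s :+ (z :- s :* s)) refl s z ⟩
      s * s + δ      ≈⟨ +-congˡ (cε≈δ 0≤δ) ⟨
      s * s + c * ε  ∎

    ε≤1 : 0# ≤ δ → ε ≤ 1#
    ε≤1 0≤δ = *-cancelˡ-≤ (0<c 0≤δ) (begin
      c * ε   ≈⟨ cε≈δ 0≤δ ⟩
      δ       ≤⟨ ≤-by (1# + (s + s)) (+-nonNegative 0≤1
                   (+-nonNegative (√-nonNegative 0≤z) (√-nonNegative 0≤z)))
                   (solve 2 (λ s d → (:1 :+ (s :+ s :+ d)) :* :1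
                     := d :+ (:1 :+ (s :+ s))) refl s δ) ⟩
      c * 1#  ∎)

    [s+ε]²≤z : 0# ≤ δ → (s + ε) * (s + ε) ≤ z
    [s+ε]²≤z 0≤δ = ≤-by (ε * (1# - ε) + ε * δ)
      (+-nonNegative (*-nonNegative 0≤ε (y-x≥0 (ε≤1 0≤δ))) (*-nonNegative 0≤ε 0≤δ))
      (trans (z≈s²+cε 0≤δ)
        (solve 3 (λ s e d → s :* s :+ (:1 :+ (s :+ s :+ d)) :* e
          := (s :+ e) :* (s :+ e) :+ (e :* (:1 :- e) :+ e :* d)) refl s ε δ))
      where
      0≤ε : 0# ≤ ε
      0≤ε = *-nonNegative 0≤δ (x⁻¹-nonNegative (0<c 0≤δ))

    ε≤0 : 0# ≤ δ → ε ≤ 0#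
    ε≤0 0≤δ = begin
      ε            ≈⟨ solve 2 (λ s e → e := s :+ e :- s) refl s ε ⟩
      s + ε - s    ≤⟨ +-monoˡ-≤ (- s) (proj₁ (√-isLUB 0≤z) (s + ε) ([s+ε]²≤z 0≤δ)) ⟩
      s - s        ≈⟨ -‿inverseʳ s ⟩
      0#           ∎

-- The exponential and the logarithm as suprema.

module Logarithm (R : CompleteOrderedField) where

  open OrderedField R
  open PartialOrderReasoning poset

  compound : ℝ → ℕ → ℝ
  compound y n = (1# + y / fromℕ (suc n)) ^ suc n

  n*[y/n]≈y : ∀ {x} y → 0# < x → x * (y / x) ≈ y
  n*[y/n]≈y {x} y 0<x = begin-equality
    x * (y * x ⁻¹)  ≈⟨ solve 3 (λ x y p → x :* (y :* p) := x :* p :* y) refl x y (x ⁻¹) ⟩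
    x * x ⁻¹ * y    ≈⟨ *-congʳ (*-inverse 0<x) ⟩
    1# * y          ≈⟨ *-identityˡ y ⟩
    y               ∎

  /-nonNegative : ∀ {x y} → 0# ≤ y → 0# < x → 0# ≤ y / x
  /-nonNegative 0≤y 0<x = *-nonNegative 0≤y (x⁻¹-nonNegative 0<x)

  1+y≤compound : ∀ {y} n → 0# ≤ y → 1# + y ≤ compound y n
  1+y≤compound {y} n 0≤y = begin
    1# + y                                    ≈⟨ +-congˡ (n*[y/n]≈y y (fromℕ-positive n)) ⟨
    1# + fromℕ (suc n) * (y / fromℕ (suc n))  ≤⟨ bernoulli (suc n) (/-nonNegative 0≤y (fromℕ-positive n)) ⟩
    compound y n                              ∎

  -- For `nr ≤ 1/2` the factor `1 - nr` in the companion of Bernoulli's inequality is at least 1/2.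
  [1+r]^n≤2 : ∀ {r} n → 0# ≤ r → fromℕ n * r + fromℕ n * r ≤ 1# → (1# + r) ^ n ≤ 1# + 1#
  [1+r]^n≤2 {r} n 0≤r 2nr≤1 = begin
    p                                    ≤⟨ ≤-by _ (*-nonNegative 0≤p (y-x≥0 2nr≤1))
                                              (solve 2 (λ p x → (:1 :+ :1) :* (p :* (:1 :- x))
                                                := p :+ p :* (:1 :- (x :+ x))) refl p (fromℕ n * r)) ⟩
    (1# + 1#) * (p * (1# - fromℕ n * r)) ≤⟨ *-monoˡ-≤ 0≤2 ([1+r]^n*[1-nr]≤1 n 0≤r) ⟩
    (1# + 1#) * 1#                       ≈⟨ *-identityʳ _ ⟩
    1# + 1#                              ∎
    where
    p = (1# + r) ^ n
    0≤p = ^-nonNegative n (+-nonNegative 0≤1 0≤r)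

  -- With r = y / (q n), both (1 + y / n) ≤ (1 + r)^q and (1 + r)^n ≤ 2.
  compound≤2^q : ∀ {y} q n → 0# ≤ y → y + y ≤ fromℕ (suc q) → compound y n ≤ (1# + 1#) ^ suc q
  compound≤2^q {y} q n 0≤y 2y≤q = begin
    (1# + y / fromℕ (suc n)) ^ suc n   ≤⟨ ^-monoˡ-≤ (suc n) 0≤1+y/n 1+y/n≤[1+r]^q ⟩
    ((1# + r) ^ suc q) ^ suc n         ≈⟨ ^-assocʳ (1# + r) (suc q) (suc n) ⟩
    (1# + r) ^ (suc q ℕ.* suc n)       ≡⟨ ≡.cong ((1# + r) ^_) (ℕ.*-comm (suc q) (suc n)) ⟩
    (1# + r) ^ (suc n ℕ.* suc q)       ≈⟨ ^-assocʳ (1# + r) (suc n) (suc q) ⟨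
    ((1# + r) ^ suc n) ^ suc q         ≤⟨ ^-monoˡ-≤ (suc q) (^-nonNegative (suc n) (+-nonNegative 0≤1 0≤r))
                                            ([1+r]^n≤2 (suc n) 0≤r 2nr≤1) ⟩
    (1# + 1#) ^ suc q                  ∎
    where
    Q = fromℕ (suc q)
    N = fromℕ (suc n)
    r = y / N / Q
    0≤1+y/n = +-nonNegative 0≤1 (/-nonNegative 0≤y (fromℕ-positive n))
    0≤r = /-nonNegative (/-nonNegative 0≤y (fromℕ-positive n)) (fromℕ-positive q)
    1+y/n≤[1+r]^q : 1# + y / N ≤ (1# + r) ^ suc q
    1+y/n≤[1+r]^q = begin
      1# + y / N       ≈⟨ +-congˡ (n*[y/n]≈y (y / N) (fromℕ-positive q)) ⟨
      1# + Q * r       ≤⟨ bernoulli (suc q) 0≤r ⟩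
      (1# + r) ^ suc q ∎
    2nr≤1 : N * r + N * r ≤ 1#
    2nr≤1 = *-cancelˡ-≤ (fromℕ-positive q) (begin
      Q * (N * r + N * r)        ≈⟨ solve 3 (λ q n r → q :* (n :* r :+ n :* r)
                                      := n :* (q :* r) :+ n :* (q :* r)) refl Q N r ⟩
      N * (Q * r) + N * (Q * r)  ≈⟨ +-cong N*Q*r≈y N*Q*r≈y ⟩
      y + y                      ≤⟨ 2y≤q ⟩
      Q                          ≈⟨ *-identityʳ Q ⟨
      Q * 1#                     ∎)
      where
      N*Q*r≈y : N * (Q * r) ≈ y
      N*Q*r≈y = trans (*-congˡ (n*[y/n]≈y (y / N) (fromℕ-positive q))) (n*[y/n]≈y y (fromℕ-positive n))

  -- The value of `sup` is known only for sets bounded above, so nothing can be said about `exp y`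
  -- until a bound `b` uniform in `n` is at hand.
  exp-isLUB : ∀ {y} b → 0# ≤ y → (∀ n → compound y n ≤ b) →
    IsLUB _≤_ (λ z → ∃[ N ] (∀ n → N ℕ.≤ n → z ≤ compound y n)) (exp y)
  exp-isLUB {y} b 0≤y u≤b = sup-isLUB _ (1# + y , 0 , λ n _ → 1+y≤compound n 0≤y)
    (b , λ { z (N , z≤u) → ≤-trans (z≤u N ℕ.≤-refl) (u≤b N) })

  exp-≤ : ∀ {y b} → 0# ≤ y → (∀ n → compound y n ≤ b) → exp y ≤ b
  exp-≤ {y} {b} 0≤y u≤b = proj₂ (exp-isLUB b 0≤y u≤b) b
    λ { z (N , z≤u) → ≤-trans (z≤u N ℕ.≤-refl) (u≤b N) }

  -- Bernoulli's inequality gives the bound for every term of the sequence; the work lies in its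
  -- boundedness, which `compound≤2^q` supplies for any natural `q ≥ 2y`.
  1+y≤exp : ∀ {y} → 0# ≤ y → 1# + y ≤ exp y
  1+y≤exp {y} 0≤y = stable λ ≰ → archimedean (y + y) λ (q , 2y≤q) → ≰
    (proj₁ (exp-isLUB ((1# + 1#) ^ suc q) 0≤y
       (λ n → compound≤2^q q n 0≤y (≤-trans 2y≤q (≤-by 1# 0≤1
         (solve 1 (λ q → :1 :+ q := q :+ :1) refl (fromℕ q))))))
     (1# + y) (0 , λ n _ → 1+y≤compound n 0≤y))

  -- Besides `exp y ≤ x`, the set under the supremum must be shown to be bounded. The number `x`
  -- itself is a bound: `t ≤ 1 + t ≤ exp t ≤ x` for `t ≥ 0`, and a nonpositive `t` lies below `x`
  -- anyway.
  ≤-log : ∀ {y x} → 0# ≤ y → (∀ n → compound y n ≤ x) → y ≤ log x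
  ≤-log {y} {x} 0≤y u≤x = proj₁ (sup-isLUB _ (y , exp-≤ 0≤y u≤x) (x , x-isUpperBound)) y (exp-≤ 0≤y u≤x)
    where
    0≤x : 0# ≤ x
    0≤x = ≤-trans (+-nonNegative 0≤1 0≤y) (≤-trans (1+y≤compound 0 0≤y) (u≤x 0))
    x-isUpperBound : IsUpperBound _≤_ (λ t → exp t ≤ x) x
    x-isUpperBound t expt≤x with total 0# t
    ... | inj₂ t≤0 = ≤-trans t≤0 0≤x
    ... | inj₁ 0≤t = begin
      t       ≤⟨ ≤-by 1# 0≤1 (solve 1 (λ t → :1 :+ t := t :+ :1) refl t) ⟩
      1# + t  ≤⟨ 1+y≤exp 0≤t ⟩
      exp t   ≤⟨ expt≤x ⟩
      x       ∎

-- Symmetric elimination: linear systems, rank-one updates, Hadamard's inequality.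

module Pivots (R : CompleteOrderedField) where

  open OrderedField R
  open SemiringSum semiring using (sum-cong-≋; ∑-distrib-+; *-distribˡ-sum)
  open PartialOrderReasoning poset

  infix 4 _≈ᵥ_

  _≈ᵥ_ : ∀ {d} → Vec d → Vec d → Set
  x ≈ᵥ y = ∀ i → x i ≈ y i

  Symmetric : ∀ {d} → Matrix d d → Set
  Symmetric M = ∀ i j → M i j ≈ M j i

  -- One step of Gaussian elimination with pivot M₀₀, for symmetric M.
  schur : ∀ {d} → Matrix (suc d) (suc d) → Matrix d d
  schur M i j = M (suc i) (suc j) - M (suc i) zero * M (suc j) zero * M zero zero ⁻¹

  -- The effect of the elimination step on the right-hand side of `M x = a`.
  reduce : ∀ {d} → Matrix (suc d) (suc d) → Vec (suc d) → Vec d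
  reduce M a i = a (suc i) - M (suc i) zero * (a zero * M zero zero ⁻¹)

  -- For symmetric matrices, positive definiteness.
  PositivePivots : ∀ {d} → Matrix d d → Set
  PositivePivots {zero}  M = ⊤
  PositivePivots {suc d} M = 0# < M zero zero × PositivePivots (schur M)

  det : ∀ {d} → Matrix d d → ℝ
  det {zero}  M = 1#
  det {suc d} M = M zero zero * det (schur M)

  -- Rows of `A` enter with weight 1; a general weight `t` is what survives an elimination step.
  rankOne : ∀ {d} → Matrix d d → ℝ → Vec d → Matrix d d
  rankOne M t a i j = M i j + t * (a i * a j)

  schur-cong : ∀ {d} {M N : Matrix (suc d) (suc d)} → 0# < M zero zero → M ≈ₘ N → schur M ≈ₘ schur N
  schur-cong 0<m M≈N i j = +-cong (M≈N (suc i) (suc j))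
    (-‿cong (*-cong (*-cong (M≈N (suc i) zero) (M≈N (suc j) zero)) (⁻¹-cong 0<m (M≈N zero zero))))

  PositivePivots-cong : ∀ {d} {M N : Matrix d d} → M ≈ₘ N → PositivePivots M → PositivePivots N
  PositivePivots-cong {zero}  M≈N _           = tt
  PositivePivots-cong {suc d} M≈N (0<m , pos) =
    <-≤-trans 0<m (≤-reflexive (M≈N zero zero)) , PositivePivots-cong (schur-cong 0<m M≈N) pos

  det-cong : ∀ {d} {M N : Matrix d d} → PositivePivots M → M ≈ₘ N → det M ≈ det N
  det-cong {zero}  _           M≈N = refl
  det-cong {suc d} (0<m , pos) M≈N = *-cong (M≈N zero zero) (det-cong pos (schur-cong 0<m M≈N))

  det-positive : ∀ {d} {M : Matrix d d} → PositivePivots M → 0# < det M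
  det-positive {zero}  _           = 0<1
  det-positive {suc d} (0<m , pos) = *-positive 0<m (det-positive pos)

  schur-symmetric : ∀ {d} {M : Matrix (suc d) (suc d)} → Symmetric M → Symmetric (schur M)
  schur-symmetric symM i j = +-cong (symM (suc i) (suc j)) (-‿cong (*-congʳ (*-comm _ _)))

  rankOne-symmetric : ∀ {d} {M : Matrix d d} t a → Symmetric M → Symmetric (rankOne M t a)
  rankOne-symmetric t a symM i j = +-cong (symM i j) (*-congˡ (*-comm _ _))

  rankOne-pivot : ∀ {m t} α → 0# < m → 0# ≤ t → 0# < m + t * (α * α)
  rankOne-pivot α 0<m 0≤t = +-positive 0<m (*-nonNegative 0≤t (x²-nonNegative α))

  -- Eliminating the first coordinate turns a rank-one update into a rank-one update.
  reducedWeight : ∀ {d} → Matrix (suc d) (suc d) → ℝ → Vec (suc d) → ℝ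
  reducedWeight M t a = t * (M zero zero * (rankOne M t a zero zero) ⁻¹)

  reducedWeight-nonNegative : ∀ {d} (M : Matrix (suc d) (suc d)) {t} a → 0# < M zero zero → 0# ≤ t →
    0# ≤ reducedWeight M t a
  reducedWeight-nonNegative M a 0<m 0≤t =
    *-nonNegative 0≤t (*-nonNegative (proj₁ 0<m) (x⁻¹-nonNegative (rankOne-pivot (a zero) 0<m 0≤t)))

  -- Modulo m p = 1 and (m + t α²) p′ = 1, an identity of polynomials.
  schur-rankOne : ∀ {d} (M : Matrix (suc d) (suc d)) {t} a → 0# < M zero zero → 0# ≤ t →
    schur (rankOne M t a) ≈ₘ rankOne (schur M) (reducedWeight M t a) (reduce M a)
  schur-rankOne M {t} a 0<m 0≤t i j = begin-equality
    n + t * (u * v) - (b + t * (u * α)) * (c + t * (v * α)) * p′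
      ≈⟨ solve 10 (λ n t u v b c α m p p′ →
           n :+ t :* (u :* v) :- (b :+ t :* (u :* α)) :* (c :+ t :* (v :* α)) :* p′
           := (n :- b :* c :* p) :+ t :* (m :* p′) :* ((u :- b :* (α :* p)) :* (v :- c :* (α :* p)))
             :+ (((m :+ t :* (α :* α)) :* p′ :- :1) :* (:- (t :* u :* v) :- b :* c :* p)
               :+ (m :* p :- :1) :* (t :* α :* p′ :* (u :* c :+ b :* v)
                                              :+ b :* c :* (p′ :- t :* α :* α :* p :* p′))))
           refl n t u v b c α m p p′ ⟩
    rhs + (((m + t * (α * α)) * p′ - 1#) * x + (m * p - 1#) * y)
      ≈⟨ +-congˡ (+-cong (*-congʳ (+-congʳ (*-inverse (rankOne-pivot α 0<m 0≤t))))
                         (*-congʳ (+-congʳ (*-inverse 0<m)))) ⟩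
    rhs + ((1# - 1#) * x + (1# - 1#) * y)
      ≈⟨ solve 3 (λ r x y → r :+ ((:1 :- :1) :* x :+ (:1 :- :1) :* y) := r)
           refl rhs x y ⟩
    rhs
      ∎
    where
    n = M (suc i) (suc j)
    b = M (suc i) zero
    c = M (suc j) zero
    u = a (suc i)
    v = a (suc j)
    α = a zero
    m = M zero zero
    p = m ⁻¹
    p′ = (m + t * (α * α)) ⁻¹
    rhs = n - b * c * p + t * (m * p′) * ((u - b * (α * p)) * (v - c * (α * p)))
    x = - (t * u * v) - b * c * p
    y = t * α * p′ * (u * c + b * v) + b * c * (p′ - t * α * α * p * p′)

  -- The first pivot can only grow, and the others are the pivots of an update of the Schur
  -- complement, again with nonnegative weight.
  rankOne-positive : ∀ {d} (M : Matrix d d) {t} a → PositivePivots M → 0# ≤ t → PositivePivots (rankOne M t a)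
  rankOne-positive {zero}  M a _           0≤t = tt
  rankOne-positive {suc d} M a (0<m , pos) 0≤t = rankOne-pivot (a zero) 0<m 0≤t ,
    PositivePivots-cong (λ i j → sym (schur-rankOne M a 0<m 0≤t i j))
      (rankOne-positive (schur M) (reduce M a) pos (reducedWeight-nonNegative M a 0<m 0≤t))

  sum-+-* : ∀ {d} c (f g : Vec d) → sum (λ j → f j + c * g j) ≈ sum f + c * sum g
  sum-+-* c f g = trans (∑-distrib-+ f _) (+-congˡ (sym (*-distribˡ-sum c g)))

  schur-*ᵥ : ∀ {d} (M : Matrix (suc d) (suc d)) y i → (schur M *ᵥ y) i ≈
    tail (M (suc i)) ∙ y - M (suc i) zero * M zero zero ⁻¹ * ((λ j → M (suc j) zero) ∙ y)
  schur-*ᵥ M y i = begin-equality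
    (schur M *ᵥ y) i
      ≈⟨ sum-cong-≋ (λ j → solve 5 (λ n b c p y → (n :- b :* c :* p) :* y
           := n :* y :+ (:- (b :* p)) :* (c :* y)) refl
           (M (suc i) (suc j)) (M (suc i) zero) (M (suc j) zero) p (y j)) ⟩
    sum (λ j → M (suc i) (suc j) * y j + - (M (suc i) zero * p) * (M (suc j) zero * y j))
      ≈⟨ sum-+-* _ (λ j → M (suc i) (suc j) * y j) (λ j → M (suc j) zero * y j) ⟩
    tail (M (suc i)) ∙ y + - (M (suc i) zero * p) * B
      ≈⟨ solve 4 (λ n b p B → n :+ (:- (b :* p)) :* B := n :- b :* p :* B) refl
           (tail (M (suc i)) ∙ y) (M (suc i) zero) p B ⟩
    tail (M (suc i)) ∙ y - M (suc i) zero * p * B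
      ∎
    where
    p = M zero zero ⁻¹
    B = (λ j → M (suc j) zero) ∙ y

  reduce-∙ : ∀ {d} (M : Matrix (suc d) (suc d)) a y →
    reduce M a ∙ y ≈ tail a ∙ y - a zero * M zero zero ⁻¹ * ((λ j → M (suc j) zero) ∙ y)
  reduce-∙ M a y = begin-equality
    reduce M a ∙ y
      ≈⟨ sum-cong-≋ (λ j → solve 4 (λ v b c y → (v :- b :* c) :* y
           := v :* y :+ (:- c) :* (b :* y)) refl (a (suc j)) (M (suc j) zero) c (y j)) ⟩
    sum (λ j → a (suc j) * y j + - c * (M (suc j) zero * y j))
      ≈⟨ sum-+-* _ (λ j → a (suc j) * y j) (λ j → M (suc j) zero * y j) ⟩
    tail a ∙ y + - c * B
      ≈⟨ solve 3 (λ v c B → v :+ (:- c) :* B := v :- c :* B) refl (tail a ∙ y) c B ⟩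
    tail a ∙ y - c * B
      ∎
    where
    c = a zero * M zero zero ⁻¹
    B = (λ j → M (suc j) zero) ∙ y

  module _ {d} (M : Matrix (suc d) (suc d)) (0<m : 0# < M zero zero) (symM : Symmetric M) where

    private
      m = M zero zero
      p = m ⁻¹
      B : Vec d → ℝ
      B y = (λ j → M (suc j) zero) ∙ y

    -- Symmetry replaces the first row by the first column, which is the part of the border that
    -- `schur` and `reduce` read.
    row₀ : ∀ x → (M *ᵥ x) zero ≈ m * head x + B (tail x)
    row₀ x = +-congˡ (sum-cong-≋ (λ j → *-congʳ (symM zero (suc j))))

    schur-solution : ∀ {x a} → M *ᵥ x ≈ᵥ a → schur M *ᵥ tail x ≈ᵥ reduce M a
    schur-solution {x} {a} Mx≈a i = begin-equality
      (schur M *ᵥ tail x) i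
        ≈⟨ schur-*ᵥ M (tail x) i ⟩
      N - b * p * B (tail x)
        -- Both `(M x)₀` and `(M x)ᵢ₊₁` are made to appear, at the price of a multiple of
        -- `m * p - 1#`, which vanishes.
        ≈⟨ solve 6 (λ b ξ N m p B → N :- b :* p :* B
             := b :* ξ :+ N :- b :* ((m :* ξ :+ B) :* p) :+ b :* ξ :* (m :* p :- :1))
             refl b (head x) N m p (B (tail x)) ⟩
      b * head x + N - b * ((m * head x + B (tail x)) * p) + b * head x * (m * p - 1#)
        ≈⟨ +-cong (+-cong (Mx≈a (suc i)) (-‿cong (*-congˡ (*-congʳ (trans (sym (row₀ x)) (Mx≈a zero))))))
             (*-congˡ (+-congʳ (*-inverse 0<m))) ⟩
      reduce M a i + b * head x * (1# - 1#)
        ≈⟨ solve 2 (λ r z → r :+ z :* (:1 :- :1) := r) refl (reduce M a i) (b * head x) ⟩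
      reduce M a i
        ∎
      where
      b = M (suc i) zero
      N = tail (M (suc i)) ∙ tail x

    -- Completing the square in `aᵀM⁻¹a`: one square over the pivot splits off, and the same form
    -- for the Schur complement remains. Both the sign of the form and the determinant formula
    -- follow from this recursion.
    ∙-solution : ∀ {x a} → M *ᵥ x ≈ᵥ a → a ∙ x ≈ a zero * a zero * p + reduce M a ∙ tail x
    ∙-solution {x} {a} Mx≈a = begin-equality
      α * head x + tail a ∙ tail x
        ≈⟨ solve 6 (λ α ξ V m p B → α :* ξ :+ V
             := α :* (m :* ξ :+ B) :* p :+ (V :- α :* p :* B) :- α :* ξ :* (m :* p :- :1))
             refl α (head x) (tail a ∙ tail x) m p (B (tail x)) ⟩
      α * (m * head x + B (tail x)) * p + (tail a ∙ tail x - α * p * B (tail x)) - α * head x * (m * p - 1#)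
        ≈⟨ +-cong (+-cong (*-congʳ (*-congˡ (trans (sym (row₀ x)) (Mx≈a zero)))) (sym (reduce-∙ M a (tail x))))
             (-‿cong (*-congˡ (+-congʳ (*-inverse 0<m)))) ⟩
      α * α * p + reduce M a ∙ tail x - α * head x * (1# - 1#)
        ≈⟨ solve 2 (λ r z → r :- z :* (:1 :- :1) := r) refl _ (α * head x) ⟩
      α * α * p + reduce M a ∙ tail x
        ∎
      where α = a zero

    backSubstitute : Vec (suc d) → Vec d → Vec (suc d)
    backSubstitute a y zero    = (a zero - B y) * p
    backSubstitute a y (suc j) = y j

    backSubstitute-solution : ∀ {a y} → schur M *ᵥ y ≈ᵥ reduce M a → M *ᵥ backSubstitute a y ≈ᵥ a
    backSubstitute-solution {a} {y} Sy≈w zero = begin-equality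
      (M *ᵥ backSubstitute a y) zero
        ≈⟨ row₀ (backSubstitute a y) ⟩
      m * ((α - B y) * p) + B y
        ≈⟨ solve 4 (λ m p α B → m :* ((α :- B) :* p) :+ B
             := α :+ (m :* p :- :1) :* (α :- B)) refl m p α (B y) ⟩
      α + (m * p - 1#) * (α - B y)
        ≈⟨ +-congˡ (*-congʳ (+-congʳ (*-inverse 0<m))) ⟩
      α + (1# - 1#) * (α - B y)
        ≈⟨ solve 2 (λ r z → r :+ (:1 :- :1) :* z := r) refl α _ ⟩
      α
        ∎
      where α = a zero
    backSubstitute-solution {a} {y} Sy≈w (suc i) = begin-equality
      b * ((a zero - B y) * p) + N
        ≈⟨ solve 5 (λ b α p B N → b :* ((α :- B) :* p) :+ N
             := N :- b :* p :* B :+ b :* (α :* p)) refl b (a zero) p (B y) N ⟩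
      N - b * p * B y + b * (a zero * p)
        ≈⟨ +-congʳ (trans (sym (schur-*ᵥ M y i)) (Sy≈w i)) ⟩
      a (suc i) - b * (a zero * p) + b * (a zero * p)
        ≈⟨ solve 2 (λ r z → r :- z :+ z := r) refl (a (suc i)) _ ⟩
      a (suc i)
        ∎
      where
      b = M (suc i) zero
      N = tail (M (suc i)) ∙ y

  solution : ∀ {d} (M : Matrix d d) → PositivePivots M → Symmetric M → ∀ a → ∃[ x ] (M *ᵥ x ≈ᵥ a)
  solution {zero}  M _           symM a = (λ ()) , λ ()
  solution {suc d} M (0<m , pos) symM a =
    let y , Sy≈w = solution (schur M) pos (schur-symmetric symM) (reduce M a)
    in backSubstitute M 0<m symM a y , backSubstitute-solution M 0<m symM Sy≈w

  ∙-nonNegative : ∀ {d} (M : Matrix d d) → PositivePivots M → Symmetric M →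
    ∀ {x a} → M *ᵥ x ≈ᵥ a → 0# ≤ a ∙ x
  ∙-nonNegative {zero}  M _           symM Mx≈a = ≤-refl
  ∙-nonNegative {suc d} M (0<m , pos) symM {x} {a} Mx≈a = begin
    0#
      ≤⟨ +-nonNegative (*-nonNegative (x²-nonNegative (a zero)) (x⁻¹-nonNegative 0<m))
           (∙-nonNegative (schur M) pos (schur-symmetric symM) {tail x} (schur-solution M 0<m symM {x} Mx≈a)) ⟩
    a zero * a zero * M zero zero ⁻¹ + reduce M a ∙ tail x
      ≈⟨ ∙-solution M 0<m symM {x} Mx≈a ⟨
    a ∙ x
      ∎

  -- The matrix determinant lemma, with a solution `x` in the place of `M⁻¹a`. If `m′ = m + t a₀²`
  -- is the new pivot and `W` the form of the Schur complement, the induction amounts to `m′ (1 + t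
  -- (m / m′) W) = m (1 + t (a₀² / m + W))`.
  det-rankOne : ∀ {d} (M : Matrix d d) → PositivePivots M → Symmetric M → ∀ {t} → 0# ≤ t →
    ∀ {x a} → M *ᵥ x ≈ᵥ a → det (rankOne M t a) ≈ det M * (1# + t * (a ∙ x))
  det-rankOne {zero}  M _           symM {t} 0≤t Mx≈a =
    solve 1 (λ t → :1 := :1 :* (:1 :+ t :* :0)) refl t
  det-rankOne {suc d} M (0<m , pos) symM {t} 0≤t {x} {a} Mx≈a = begin-equality
    m′ * det (schur (rankOne M t a))
      ≈⟨ *-congˡ (det-cong (proj₂ (rankOne-positive M a (0<m , pos) 0≤t)) (schur-rankOne M a 0<m 0≤t)) ⟩
    m′ * det (rankOne (schur M) (reducedWeight M t a) (reduce M a))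
      ≈⟨ *-congˡ (det-rankOne (schur M) pos (schur-symmetric symM) (reducedWeight-nonNegative M a 0<m 0≤t)
           {tail x} (schur-solution M 0<m symM {x} Mx≈a)) ⟩
    m′ * (D * (1# + t * (m * m′ ⁻¹) * W))
      ≈⟨ solve 7 (λ α t m p D W p′ → (m :+ t :* (α :* α)) :* (D :* (:1 :+ t :* (m :* p′) :* W))
           := m :* D :* (:1 :+ t :* (α :* α :* p :+ W))
             :+ (((m :+ t :* (α :* α)) :* p′ :- :1) :* (D :* t :* m :* W)
               :- (m :* p :- :1) :* (t :* α :* α :* D)))
           refl (a zero) t m (m ⁻¹) D W (m′ ⁻¹) ⟩
    m * D * (1# + t * (a zero * a zero * m ⁻¹ + W))
      + ((m′ * m′ ⁻¹ - 1#) * (D * t * m * W) - (m * m ⁻¹ - 1#) * (t * a zero * a zero * D))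
      ≈⟨ +-cong (*-congˡ (+-congˡ (*-congˡ (sym (∙-solution M 0<m symM {x} Mx≈a)))))
           (+-cong (*-congʳ (+-congʳ (*-inverse (rankOne-pivot (a zero) 0<m 0≤t))))
             (-‿cong (*-congʳ (+-congʳ (*-inverse 0<m))))) ⟩
    m * D * (1# + t * (a ∙ x)) + ((1# - 1#) * (D * t * m * W) - (1# - 1#) * (t * a zero * a zero * D))
      ≈⟨ solve 3 (λ r x y → r :+ ((:1 :- :1) :* x :- (:1 :- :1) :* y) := r)
           refl _ (D * t * m * W) (t * a zero * a zero * D) ⟩
    m * D * (1# + t * (a ∙ x))
      ∎
    where
    m = M zero zero
    m′ = rankOne M t a zero zero
    D = det (schur M)
    W = reduce M a ∙ tail x

  -- Elimination subtracts a square over the pivot from each diagonal entry, so `β` still bounds the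
  -- diagonal of the Schur complement.
  hadamard : ∀ {d β} (M : Matrix d d) → PositivePivots M → (∀ i → M i i ≤ β) → det M ≤ β ^ d
  hadamard {zero}  M _           Mᵢᵢ≤β = ≤-refl
  hadamard {suc d} {β} M (0<m , pos) Mᵢᵢ≤β =
    *-mono-≤ (proj₁ 0<m) (^-nonNegative d (≤-trans (proj₁ 0<m) (Mᵢᵢ≤β zero))) (Mᵢᵢ≤β zero)
      (hadamard (schur M) pos λ i → ≤-trans
        (≤-by _ (*-nonNegative (x²-nonNegative (M (suc i) zero)) (x⁻¹-nonNegative 0<m))
          (solve 2 (λ n z → n := n :- z :+ z) refl (M (suc i) (suc i)) _))
        (Mᵢᵢ≤β (suc i)))

  schur-scale : ∀ {d} lam → schur (scale {suc d} lam 𝕀) ≈ₘ scale lam 𝕀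
  schur-scale lam i j =
    solve 3 (λ l e q → l :* e :- l :* :0 :* (l :* :0) :* q := l :* e)
      refl lam (𝕀 i j) ((lam * 1#) ⁻¹)

  scale-positive : ∀ d {lam} → 0# < lam → PositivePivots (scale {d} lam 𝕀)
  scale-positive zero    0<lam = tt
  scale-positive (suc d) 0<lam = <-≤-trans 0<lam (≤-reflexive (sym (*-identityʳ _))) ,
    PositivePivots-cong (λ i j → sym (schur-scale _ i j)) (scale-positive d 0<lam)

  det-scale : ∀ d {lam} → 0# < lam → det (scale {d} lam 𝕀) ≈ lam ^ d
  det-scale zero    0<lam = refl
  det-scale (suc d) 0<lam = *-cong (*-identityʳ _)
    (trans (det-cong (proj₂ (scale-positive (suc d) 0<lam)) (schur-scale _)) (det-scale d 0<lam))

-- Inverses, Gram matrices and the spectral norm.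

module MatrixAlgebra (R : CompleteOrderedField) where

  open OrderedField R
  open Pivots R
  open SemiringSum semiring
    using (sum-cong-≋; ∑-comm; *-distribˡ-sum; *-distribʳ-sum; sum-replicate-zero)
  open PartialOrderReasoning poset

  sum-mono-≤ : ∀ {n} {f g : Vec n} → (∀ i → f i ≤ g i) → sum f ≤ sum g
  sum-mono-≤ {zero}  f≤g = ≤-refl
  sum-mono-≤ {suc n} f≤g = +-mono-≤ (f≤g zero) (sum-mono-≤ (f≤g ∘ suc))

  sum-nonNegative : ∀ {n} {f : Vec n} → (∀ i → 0# ≤ f i) → 0# ≤ sum f
  sum-nonNegative {zero}  0≤f = ≤-refl
  sum-nonNegative {suc n} 0≤f = +-nonNegative (0≤f zero) (sum-nonNegative (0≤f ∘ suc))

  sum-0 : ∀ {n} {f : Vec n} → f ≈ᵥ (λ _ → 0#) → sum f ≈ 0#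
  sum-0 {n} f≈0 = trans (sum-cong-≋ f≈0) (sum-replicate-zero n)

  ∙-cong : ∀ {d} {x x′ y y′ : Vec d} → x ≈ᵥ x′ → y ≈ᵥ y′ → x ∙ y ≈ x′ ∙ y′
  ∙-cong x≈x′ y≈y′ = sum-cong-≋ λ i → *-cong (x≈x′ i) (y≈y′ i)

  ∙-comm : ∀ {d} (x y : Vec d) → x ∙ y ≈ y ∙ x
  ∙-comm x y = sum-cong-≋ λ i → *-comm (x i) (y i)

  𝕀-symmetric : ∀ {d} → Symmetric (𝕀 {d})
  𝕀-symmetric zero    zero    = refl
  𝕀-symmetric zero    (suc j) = refl
  𝕀-symmetric (suc i) zero    = refl
  𝕀-symmetric (suc i) (suc j) = 𝕀-symmetric i j

  𝕀-diagonal : ∀ {d} (i : Fin d) → 𝕀 i i ≈ 1#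
  𝕀-diagonal zero    = refl
  𝕀-diagonal (suc i) = 𝕀-diagonal i

  𝕀-*ᵥ : ∀ {d} (x : Vec d) → 𝕀 *ᵥ x ≈ᵥ x
  𝕀-*ᵥ x zero = trans (+-cong (*-identityˡ _) (sum-0 λ j → zeroˡ (x (suc j)))) (+-identityʳ _)
  𝕀-*ᵥ x (suc i) = trans (+-cong (zeroˡ _) (𝕀-*ᵥ (tail x) i)) (+-identityˡ _)

  ∙-𝕀 : ∀ {d} (x : Vec d) j → x ∙ 𝕀 j ≈ x j
  ∙-𝕀 x j = trans (∙-comm x (𝕀 j)) (𝕀-*ᵥ x j)

  *ₘ-*ᵥ-assoc : ∀ {n m d} (L : Matrix n m) (M : Matrix m d) x → (L *ₘ M) *ᵥ x ≈ᵥ L *ᵥ (M *ᵥ x)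
  *ₘ-*ᵥ-assoc L M x i = begin-equality
    sum (λ k → sum (λ l → L i l * M l k) * x k)
      ≈⟨ sum-cong-≋ (λ k → *-distribʳ-sum (x k) (λ l → L i l * M l k)) ⟩
    sum (λ k → sum (λ l → L i l * M l k * x k))
      ≈⟨ ∑-comm (λ k l → L i l * M l k * x k) ⟩
    sum (λ l → sum (λ k → L i l * M l k * x k))
      ≈⟨ sum-cong-≋ (λ l → sum-cong-≋ λ k → *-assoc (L i l) (M l k) (x k)) ⟩
    sum (λ l → sum (λ k → L i l * (M l k * x k)))
      ≈⟨ sum-cong-≋ (λ l → *-distribˡ-sum (L i l) (λ k → M l k * x k)) ⟨
    sum (λ l → L i l * sum (λ k → M l k * x k))
      ∎

  leftInverse≈rightInverse : ∀ {d} (L M N : Matrix d d) → L *ₘ M ≈ₘ 𝕀 → M *ₘ N ≈ₘ 𝕀 → L ≈ₘ N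
  leftInverse≈rightInverse L M N LM≈𝕀 MN≈𝕀 i j = begin-equality
    L i j                       ≈⟨ ∙-𝕀 (L i) j ⟨
    L i ∙ 𝕀 j                   ≈⟨ ∙-cong (λ _ → refl) (λ k → trans (𝕀-symmetric j k) (sym (MN≈𝕀 k j))) ⟩
    (L *ᵥ (M *ᵥ (N ᵀ) j)) i     ≈⟨ *ₘ-*ᵥ-assoc L M ((N ᵀ) j) i ⟨
    ((L *ₘ M) *ᵥ (N ᵀ) j) i     ≈⟨ ∙-cong (LM≈𝕀 i) (λ _ → refl) ⟩
    (𝕀 *ᵥ (N ᵀ) j) i            ≈⟨ 𝕀-*ᵥ ((N ᵀ) j) i ⟩
    N i j                       ∎

  -- A right inverse N of a symmetric M is a left inverse, since Nᵀ is one.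
  invertible : ∀ {d} (M : Matrix d d) → PositivePivots M → Symmetric M → ∃[ N ] IsInverse M N
  invertible {d} M pos symM = N , MN≈𝕀 , NM≈𝕀
    where
    N : Matrix d d
    N i j = proj₁ (solution M pos symM (𝕀 j)) i
    MN≈𝕀 : M *ₘ N ≈ₘ 𝕀
    MN≈𝕀 i j = trans (proj₂ (solution M pos symM (𝕀 j)) i) (𝕀-symmetric j i)
    NᵀM≈𝕀 : N ᵀ *ₘ M ≈ₘ 𝕀
    NᵀM≈𝕀 i j = begin-equality
      (N ᵀ) i ∙ (M ᵀ) j   ≈⟨ ∙-comm ((N ᵀ) i) ((M ᵀ) j) ⟩
      (M ᵀ) j ∙ (N ᵀ) i   ≈⟨ ∙-cong (λ k → symM k j) (λ _ → refl) ⟩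
      M j ∙ (N ᵀ) i       ≈⟨ MN≈𝕀 j i ⟩
      𝕀 j i               ≈⟨ 𝕀-symmetric j i ⟩
      𝕀 i j               ∎
    NM≈𝕀 : N *ₘ M ≈ₘ 𝕀
    NM≈𝕀 i j = trans
      (∙-cong (λ k → sym (leftInverse≈rightInverse (N ᵀ) M N NᵀM≈𝕀 MN≈𝕀 i k)) (λ _ → refl))
      (NᵀM≈𝕀 i j)

  inverse-unique : ∀ {d} (M : Matrix d d) {N} → IsInverse M N → inverse M ≈ₘ N
  inverse-unique M {N} inv@(MN≈𝕀 , _) i j =
    antisym (proj₂ lub (N i j) isUpperBound) (proj₁ lub (N i j) (N , inv , refl))
    where
    isUpperBound : IsUpperBound _≤_ (λ t → ∃[ N ] (IsInverse M N × t ≈ N i j)) (N i j)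
    isUpperBound t (N′ , (_ , N′M≈𝕀) , t≈) =
      ≤-reflexive (trans t≈ (leftInverse≈rightInverse N′ M N N′M≈𝕀 MN≈𝕀 i j))
    lub = sup-isLUB (λ t → ∃[ N ] (IsInverse M N × t ≈ N i j))
      (N i j , N , inv , refl) (N i j , isUpperBound)

  -- The link between `inverse`, an entrywise supremum, and the elimination argument, which speaks
  -- only of solutions of linear systems.
  inverse-solution : ∀ {d} (M : Matrix d d) → PositivePivots M → Symmetric M → ∀ a →
    M *ᵥ (inverse M *ᵥ a) ≈ᵥ a
  inverse-solution M pos symM a i = begin-equality
    (M *ᵥ (inverse M *ᵥ a)) i
      ≈⟨ ∙-cong {x = M i} (λ _ → refl) (λ k → ∙-cong (inverse-unique M inv k) (λ _ → refl)) ⟩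
    (M *ᵥ (N *ᵥ a)) i
      ≈⟨ *ₘ-*ᵥ-assoc M N a i ⟨
    ((M *ₘ N) *ᵥ a) i
      ≈⟨ ∙-cong (proj₁ inv i) (λ _ → refl) ⟩
    (𝕀 *ᵥ a) i
      ≈⟨ 𝕀-*ᵥ a i ⟩
    a i
      ∎
    where
    N = proj₁ (invertible M pos symM)
    inv = proj₂ (invertible M pos symM)

  gram : ∀ {n d} → Matrix n d → Matrix d d
  gram A = A ᵀ *ₘ A

  gram-+-symmetric : ∀ {n d} (A : Matrix n d) {G} → Symmetric G → Symmetric (gram A +ₘ G)
  gram-+-symmetric A symG i j = +-cong (∙-comm ((A ᵀ) i) ((A ᵀ) j)) (symG i j)

  -- Moves the first row from the Gram part to the additive part. Recursion on `A` then adds the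
  -- rows in their given order, which is why `G` is arbitrary and not just `λI`.
  gram-+-suc : ∀ {n d} (A : Matrix (suc n) d) G → gram A +ₘ G ≈ₘ gram (tail A) +ₘ rankOne G 1# (head A)
  gram-+-suc A G i j = solve 4 (λ a b g t → a :* b :+ t :+ g := t :+ (g :+ :1 :* (a :* b))) refl
    (A zero i) (A zero j) (G i j) (gram (tail A) i j)

  gram-+-positive : ∀ {n d} (A : Matrix n d) {G} → PositivePivots G → PositivePivots (gram A +ₘ G)
  gram-+-positive {zero}  A {G} pos = PositivePivots-cong (λ i j → sym (+-identityˡ (G i j))) pos
  gram-+-positive {suc n} A {G} pos = PositivePivots-cong (λ i j → sym (gram-+-suc A G i j))
    (gram-+-positive (tail A) (rankOne-positive G (head A) pos 0≤1))

  ∙-self-nonNegative : ∀ {d} (x : Vec d) → 0# ≤ x ∙ x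
  ∙-self-nonNegative x = sum-nonNegative λ i → x²-nonNegative (x i)

  -- A weak substitute for the squared length in the Cauchy-Schwarz inequality, obtained by
  -- iterating `(u + v)² ≤ 2u² + 2v²`. Its exponential size is harmless: it only shows that the set
  -- defining `∥ A ∥₂` is bounded.
  crudeBound : ∀ {d} → Vec d → ℝ
  crudeBound {zero}  a = 0#
  crudeBound {suc d} a = (1# + 1#) * (a zero * a zero + crudeBound (tail a))

  crudeBound-nonNegative : ∀ {d} (a : Vec d) → 0# ≤ crudeBound a
  crudeBound-nonNegative {zero}  a = ≤-refl
  crudeBound-nonNegative {suc d} a =
    *-nonNegative 0≤2 (+-nonNegative (x²-nonNegative (a zero)) (crudeBound-nonNegative (tail a)))

  ∙²≤crudeBound : ∀ {d} (a x : Vec d) → (a ∙ x) * (a ∙ x) ≤ crudeBound a * (x ∙ x)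
  ∙²≤crudeBound {zero}  a x = ≤-refl
  ∙²≤crudeBound {suc d} a x = ≤-by _
    (+-nonNegative
      (*-nonNegative 0≤2
        (+-nonNegative (+-nonNegative (*-nonNegative (x²-nonNegative α) (∙-self-nonNegative (tail x)))
                                      (*-nonNegative (crudeBound-nonNegative (tail a)) (x²-nonNegative ξ)))
                       (y-x≥0 (∙²≤crudeBound (tail a) (tail x)))))
      (x²-nonNegative (α * ξ - s)))
    (solve 5 (λ α ξ s B Y →
      (:1 :+ :1) :* (α :* α :+ B) :* (ξ :* ξ :+ Y)
      := (α :* ξ :+ s) :* (α :* ξ :+ s)
         :+ ((:1 :+ :1) :* (α :* α :* Y :+ B :* (ξ :* ξ) :+ (B :* Y :- s :* s))
         :+ (α :* ξ :- s) :* (α :* ξ :- s)))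
      refl α ξ s (crudeBound (tail a)) (tail x ∙ tail x))
    where
    α = a zero
    ξ = x zero
    s = tail a ∙ tail x

  ∥*ᵥ∥-bounded : ∀ {n d} (A : Matrix n d) x → ∥ x ∥ ≤ 1# → ∥ A *ᵥ x ∥ ≤ 1# + sum (crudeBound ∘ A)
  ∥*ᵥ∥-bounded A x ∥x∥≤1 = √-≤ (∙-self-nonNegative (A *ᵥ x)) (+-nonNegative 0≤1 0≤B) (begin
    (A *ᵥ x) ∙ (A *ᵥ x)                   ≤⟨ sum-mono-≤ (λ i → ∙²≤crudeBound (A i) x) ⟩
    sum (λ i → crudeBound (A i) * (x ∙ x)) ≤⟨ sum-mono-≤ (λ i → *-monoˡ-≤ (crudeBound-nonNegative (A i)) x∙x≤1) ⟩
    sum (λ i → crudeBound (A i) * 1#)      ≈⟨ sum-cong-≋ (λ i → *-identityʳ (crudeBound (A i))) ⟩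
    B                                     ≤⟨ ≤-by (1# + B + B * B)
                                               (+-nonNegative (+-nonNegative 0≤1 0≤B) (x²-nonNegative B))
                                               (solve 1 (λ B → (:1 :+ B) :* (:1 :+ B)
                                                 := B :+ (:1 :+ B :+ B :* B)) refl B) ⟩
    (1# + B) * (1# + B)                   ∎)
    where
    B = sum (crudeBound ∘ A)
    0≤B = sum-nonNegative (crudeBound-nonNegative ∘ A)
    x∙x≤1 : x ∙ x ≤ 1#
    x∙x≤1 = begin
      x ∙ x          ≤⟨ z≤√z² (∙-self-nonNegative x) ⟩
      ∥ x ∥ * ∥ x ∥  ≤⟨ *-mono-≤ (√-nonNegative (∙-self-nonNegative x)) 0≤1 ∥x∥≤1 ∥x∥≤1 ⟩
      1# * 1#        ≈⟨ *-identityˡ 1# ⟩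
      1#             ∎

  -- The entry is the squared length of `A eⱼ`, where the unit vector `eⱼ` is the row `𝕀 j`.
  gram-diagonal-≤ : ∀ {n d} (A : Matrix n d) j → gram A j j ≤ ∥ A ∥₂ * ∥ A ∥₂
  gram-diagonal-≤ A j = begin
    gram A j j                        ≈⟨ ∙-cong (λ i → ∙-𝕀 (A i) j) (λ i → ∙-𝕀 (A i) j) ⟨
    (A *ᵥ 𝕀 j) ∙ (A *ᵥ 𝕀 j)           ≤⟨ z≤√z² 0≤z ⟩
    ∥ A *ᵥ 𝕀 j ∥ * ∥ A *ᵥ 𝕀 j ∥       ≤⟨ *-mono-≤ (√-nonNegative 0≤z) (≤-trans (√-nonNegative 0≤z) ∥Aeⱼ∥≤∥A∥)
                                           ∥Aeⱼ∥≤∥A∥ ∥Aeⱼ∥≤∥A∥ ⟩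
    ∥ A ∥₂ * ∥ A ∥₂                   ∎
    where
    0≤z = ∙-self-nonNegative (A *ᵥ 𝕀 j)
    ∥eⱼ∥≤1 : ∥ 𝕀 j ∥ ≤ 1#
    ∥eⱼ∥≤1 = √-≤ (∙-self-nonNegative (𝕀 j)) 0≤1
      (≤-reflexive (trans (trans (∙-𝕀 (𝕀 j) j) (𝕀-diagonal j)) (sym (*-identityˡ 1#))))
    ∥Aeⱼ∥≤∥A∥ : ∥ A *ᵥ 𝕀 j ∥ ≤ ∥ A ∥₂
    ∥Aeⱼ∥≤∥A∥ = proj₁ (sup-isLUB (λ t → ∃[ x ] (∥ x ∥ ≤ 1# × t ≈ ∥ A *ᵥ x ∥)) (_ , 𝕀 j , ∥eⱼ∥≤1 , refl)
      (_ , λ { t (x , ∥x∥≤1 , t≈) → ≤-trans (≤-reflexive t≈) (∥*ᵥ∥-bounded A x ∥x∥≤1) }))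
      _ (𝕀 j , ∥eⱼ∥≤1 , refl)

-- Leverage scores, growth of the determinant, and the final bound.

module LeverageScores (R : CompleteOrderedField) where

  open OrderedField R
  open Logarithm R
  open Pivots R
  open MatrixAlgebra R
  open Min (DecTotalOrder.totalOrder decTotalOrder) using (minOperator)
  open MinOp minOperator using (x⊓y≤x; x⊓y≤y; ⊓-glb)
  open PartialOrderReasoning poset

  module _ (N : ℕ) {c : ℝ} (0≤c : 0# ≤ c) (2Nc≈1 : fromℕ N * c + fromℕ N * c ≈ 1#) where

    -- Since `Nc = 1/2`, the left-hand side is at most `1 / (1 - l/2)`, and
    -- `(1 - l/2)(1 + l) = 1 + l(1 - l)/2 ≥ 1` for `l` in [0, 1].
    [1+cl]^N≤1+l : ∀ {l} → 0# ≤ l → l ≤ 1# → (1# + c * l) ^ N ≤ 1# + l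
    [1+cl]^N≤1+l {l} 0≤l l≤1 = begin
      p
        -- The term `l * (1# - (h + h))` is zero because `h` is 1/2; carrying it along makes the
        -- identity hold for every `h`, as the solver requires.
        ≤⟨ ≤-by (p * (h * (l * (1# - l))))
             (*-nonNegative 0≤p (*-nonNegative (*-nonNegative (fromℕ-nonNegative N) 0≤c)
               (*-nonNegative 0≤l (y-x≥0 l≤1))))
             (solve 3 (λ p h l → p :* ((:1 :- h :* l) :* (:1 :+ l) :- l :* (:1 :- (h :+ h)))
               := p :+ p :* (h :* (l :* (:1 :- l)))) refl p h l) ⟩
      p * ((1# - h * l) * (1# + l) - l * (1# - (h + h)))
        ≈⟨ *-congˡ (+-congˡ (-‿cong (*-congˡ (+-congˡ (-‿cong 2Nc≈1))))) ⟩
      p * ((1# - h * l) * (1# + l) - l * (1# - 1#))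
        ≈⟨ solve 4 (λ p n c l → p :* ((:1 :- n :* c :* l) :* (:1 :+ l) :- l :* (:1 :- :1))
             := (:1 :+ l) :* (p :* (:1 :- n :* (c :* l)))) refl p (fromℕ N) c l ⟩
      (1# + l) * (p * (1# - fromℕ N * (c * l)))
        ≤⟨ *-monoˡ-≤ (+-nonNegative 0≤1 0≤l) ([1+r]^n*[1-nr]≤1 N (*-nonNegative 0≤c 0≤l)) ⟩
      (1# + l) * 1#
        ≈⟨ *-identityʳ _ ⟩
      1# + l
        ∎
      where
      h = fromℕ N * c
      p = (1# + c * l) ^ N
      0≤p = ^-nonNegative N (+-nonNegative 0≤1 (*-nonNegative 0≤c 0≤l))

    -- Each row multiplies the determinant by 1 + aᵢ ∙ x ≥ 1 + lᵢ ≥ (1 + c lᵢ)^N.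
    det-growth : ∀ {n d} (A : Matrix n d) (G : Matrix d d) → PositivePivots G → Symmetric G →
      (l : Vec n) → (∀ i → 0# ≤ l i) → (∀ i → l i ≤ 1#) →
      (∀ i → ∃[ x ] ((gram (firstRows A (inject₁ i)) +ₘ G) *ᵥ x ≈ᵥ A i × l i ≤ A i ∙ x)) →
      det G * (1# + c * sum l) ^ N ≤ det (gram A +ₘ G)
    det-growth {zero} A G pos symG l 0≤l l≤1 l≤a∙x = begin
      det G * (1# + c * 0#) ^ N  ≈⟨ *-congˡ (^-congˡ N (trans (+-congˡ (zeroʳ c)) (+-identityʳ 1#))) ⟩
      det G * 1# ^ N             ≈⟨ *-congˡ (1^n≈1 N) ⟩
      det G * 1#                 ≈⟨ *-identityʳ _ ⟩
      det G                      ≈⟨ det-cong pos (λ i j → sym (+-identityˡ (G i j))) ⟩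
      det (gram A +ₘ G)          ∎
    det-growth {suc n} A G pos symG l 0≤l l≤1 l≤a∙x = begin
      det G * (1# + c * (l₀ + S)) ^ N
        -- The product over the rows becomes a sum here, one factor at a time:
        -- `Π (1 + c lᵢ) ≥ 1 + c Σ lᵢ`, inside the `N`-th power.
        ≤⟨ *-monoˡ-≤ 0≤detG (^-monoˡ-≤ N (1+c*-nonNegative (+-nonNegative (0≤l zero) 0≤S))
             (≤-by _ (*-nonNegative (*-nonNegative 0≤c (0≤l zero)) (*-nonNegative 0≤c 0≤S))
               (solve 3 (λ c l s → (:1 :+ c :* l) :* (:1 :+ c :* s)
                 := :1 :+ c :* (l :+ s) :+ c :* l :* (c :* s)) refl c l₀ S))) ⟩
      det G * ((1# + c * l₀) * (1# + c * S)) ^ N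
        ≈⟨ *-congˡ (^-distrib-* _ _ N) ⟩
      det G * ((1# + c * l₀) ^ N * (1# + c * S) ^ N)
        ≤⟨ *-monoˡ-≤ 0≤detG (*-mono-≤ (^-nonNegative N (1+c*-nonNegative (0≤l zero)))
             (^-nonNegative N (1+c*-nonNegative 0≤S)) 1+l₀≤ ≤-refl) ⟩
      det G * ((1# + 1# * (A zero ∙ x)) * (1# + c * S) ^ N)
        ≈⟨ *-assoc _ _ _ ⟨
      det G * (1# + 1# * (A zero ∙ x)) * (1# + c * S) ^ N
        ≈⟨ *-congʳ (det-rankOne G pos symG 0≤1 {x} Gx≈a) ⟨
      det G′ * (1# + c * S) ^ N
        ≤⟨ det-growth (tail A) G′ pos′ (rankOne-symmetric 1# (A zero) symG)
             (tail l) (0≤l ∘ suc) (l≤1 ∘ suc) l≤a∙x′ ⟩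
      det (gram (tail A) +ₘ G′)
        ≈⟨ det-cong (gram-+-positive (tail A) pos′) (λ i j → sym (gram-+-suc A G i j)) ⟩
      det (gram A +ₘ G)
        ∎
      where
      l₀ = l zero
      S = sum (tail l)
      0≤S = sum-nonNegative (0≤l ∘ suc)
      0≤detG = proj₁ (det-positive pos)
      x = proj₁ (l≤a∙x zero)
      G′ = rankOne G 1# (A zero)
      pos′ = rankOne-positive G (A zero) pos 0≤1
      1+c*-nonNegative : ∀ {s} → 0# ≤ s → 0# ≤ 1# + c * s
      1+c*-nonNegative 0≤s = +-nonNegative 0≤1 (*-nonNegative 0≤c 0≤s)
      Gx≈a : G *ᵥ x ≈ᵥ A zero
      -- No row precedes row zero, so the Gram part is an empty sum.
      Gx≈a i = trans (∙-cong (λ j → sym (+-identityˡ (G i j))) (λ _ → refl)) (proj₁ (proj₂ (l≤a∙x zero)) i)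
      1+l₀≤ : (1# + c * l₀) ^ N ≤ 1# + 1# * (A zero ∙ x)
      1+l₀≤ = ≤-trans ([1+cl]^N≤1+l (0≤l zero) (l≤1 zero))
        (+-mono-≤ ≤-refl (≤-trans (proj₂ (proj₂ (l≤a∙x zero))) (≤-reflexive (sym (*-identityˡ _)))))
      l≤a∙x′ : ∀ i → ∃[ x ] ((gram (firstRows (tail A) (inject₁ i)) +ₘ G′) *ᵥ x ≈ᵥ A (suc i)
        × l (suc i) ≤ A (suc i) ∙ x)
      l≤a∙x′ i =
        -- The same `x` serves: shifting the first row into `G′` does not change the matrix of the
        -- system.
        let x , eq , l≤ = l≤a∙x (suc i)
            M≈M′ = gram-+-suc (firstRows A (inject₁ (suc i))) G
        in x , (λ k → trans (∙-cong (λ j → sym (M≈M′ k j)) (λ _ → refl)) (eq k)) , l≤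

  module _ {n d} (A : Matrix n d) {lam : ℝ} (0<lam : 0# < lam) where

    private
      Λ : Matrix d d
      Λ = scale lam 𝕀

      Λ-positive : PositivePivots Λ
      Λ-positive = scale-positive d 0<lam

      Λ-symmetric : Symmetric Λ
      Λ-symmetric i j = *-congˡ (𝕀-symmetric i j)

      ridge : Fin n → Matrix d d
      ridge i = gram (firstRows A (inject₁ i)) +ₘ Λ

      ridge-solution : ∀ i → ridge i *ᵥ (inverse (ridge i) *ᵥ A i) ≈ᵥ A i
      ridge-solution i = inverse-solution (ridge i) (gram-+-positive (firstRows A (inject₁ i)) Λ-positive)
        (gram-+-symmetric (firstRows A (inject₁ i)) Λ-symmetric) (A i)

    leverage-nonNegative : ∀ i → 0# ≤ leverage A lam i
    leverage-nonNegative i = ⊓-glb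
      (∙-nonNegative (ridge i) (gram-+-positive (firstRows A (inject₁ i)) Λ-positive)
        (gram-+-symmetric (firstRows A (inject₁ i)) Λ-symmetric) {inverse (ridge i) *ᵥ A i} (ridge-solution i))
      0≤1

    det-≤ : det (gram A +ₘ Λ) ≤ (∥ A ∥₂ * ∥ A ∥₂ + lam) ^ d
    det-≤ = hadamard (gram A +ₘ Λ) (gram-+-positive A Λ-positive) λ j → +-mono-≤ (gram-diagonal-≤ A j)
      (≤-reflexive (trans (*-congˡ (𝕀-diagonal j)) (*-identityʳ lam)))

    [1+c*sum]^N≤[1+ρ]^d : ∀ N {c} → 0# ≤ c → fromℕ N * c + fromℕ N * c ≈ 1# →
      (1# + c * sum (leverage A lam)) ^ N ≤ (1# + ∥ A ∥₂ ^ 2 / lam) ^ d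
    [1+c*sum]^N≤[1+ρ]^d N {c} 0≤c 2Nc≈1 = *-cancelˡ-≤ (^-positive d 0<lam) (begin
      lam ^ d * (1# + c * sum (leverage A lam)) ^ N
        ≈⟨ *-congʳ (det-scale d 0<lam) ⟨
      det Λ * (1# + c * sum (leverage A lam)) ^ N
        ≤⟨ det-growth N 0≤c 2Nc≈1 A Λ Λ-positive Λ-symmetric (leverage A lam) leverage-nonNegative
             (λ i → x⊓y≤y _ 1#) (λ i → inverse (ridge i) *ᵥ A i , ridge-solution i , x⊓y≤x _ 1#) ⟩
      det (gram A +ₘ Λ)
        ≤⟨ det-≤ ⟩
      (∥ A ∥₂ * ∥ A ∥₂ + lam) ^ d
        ≈⟨ ^-congˡ d a²+lam≈lam[1+ρ] ⟩
      (lam * (1# + ∥ A ∥₂ ^ 2 / lam)) ^ d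
        ≈⟨ ^-distrib-* _ _ d ⟩
      lam ^ d * (1# + ∥ A ∥₂ ^ 2 / lam) ^ d
        ∎)
      where
      a²+lam≈lam[1+ρ] : ∥ A ∥₂ * ∥ A ∥₂ + lam ≈ lam * (1# + ∥ A ∥₂ ^ 2 / lam)
      a²+lam≈lam[1+ρ] = begin-equality
        ∥ A ∥₂ * ∥ A ∥₂ + lam
          ≈⟨ +-congʳ (trans (n*[y/n]≈y _ 0<lam) (*-congˡ (*-identityʳ ∥ A ∥₂))) ⟨
        lam * (∥ A ∥₂ ^ 2 / lam) + lam
          ≈⟨ solve 2 (λ l r → l :* r :+ l := l :* (:1 :+ r)) refl lam (∥ A ∥₂ ^ 2 / lam) ⟩
        lam * (1# + ∥ A ∥₂ ^ 2 / lam)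
          ∎

    sum-leverage-nonNegative : 0# ≤ sum (leverage A lam)
    sum-leverage-nonNegative = sum-nonNegative leverage-nonNegative

  -- The dimension is a successor so that one can divide by `q` and cancel a `kd`-th power. The sign
  -- of the logarithm comes for free from `0 ≤ s ≤ log ρ`.
  sum-leverage-≤ : ∀ {n d} (A : Matrix n (suc d)) {lam} → 0# < lam → ∀ k →
    0# ≤ ∥ A ∥₂ ^ 2 / lam → 1# + ∥ A ∥₂ ^ 2 / lam ≤ (∥ A ∥₂ ^ 2 / lam) ^ suc k →
    0# ≤ log (∥ A ∥₂ ^ 2 / lam) ×
    sum (leverage A lam) ≤ (fromℕ (suc k) + fromℕ (suc k)) * (fromℕ (suc d) * log (∥ A ∥₂ ^ 2 / lam))
  sum-leverage-≤ {d = d} A {lam} 0<lam k 0≤ρ 1+ρ≤ρᵏ = ≤-trans 0≤s s≤logρ , (begin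
    S                    ≈⟨ n*[y/n]≈y S 0<2q ⟨
    (q + q) * s          ≤⟨ *-monoˡ-≤ (proj₁ 0<2q) s≤logρ ⟩
    (q + q) * log ρ      ≈⟨ *-congʳ (+-cong (fromℕ-* (suc k) (suc d)) (fromℕ-* (suc k) (suc d))) ⟩
    (fromℕ (suc k) * fromℕ (suc d) + fromℕ (suc k) * fromℕ (suc d)) * log ρ
                         ≈⟨ solve 3 (λ k d l → (k :* d :+ k :* d) :* l := (k :+ k) :* (d :* l)) refl
                              (fromℕ (suc k)) (fromℕ (suc d)) (log ρ) ⟩
    (fromℕ (suc k) + fromℕ (suc k)) * (fromℕ (suc d) * log ρ) ∎)
    where
    S = sum (leverage A lam)
    ρ = ∥ A ∥₂ ^ 2 / lam
    kd = suc k ℕ.* suc d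
    q = fromℕ kd
    0<q : 0# < q
    0<q = fromℕ-positive (ℕ.pred kd)
    0<2q : 0# < q + q
    0<2q = +-positive 0<q (proj₁ 0<q)
    s = S / (q + q)
    0≤s : 0# ≤ s
    0≤s = /-nonNegative (sum-leverage-nonNegative A 0<lam) 0<2q
    compound≤ρ : ∀ m → compound s m ≤ ρ
    compound≤ρ m = ^-cancelˡ-≤ (ℕ.pred kd) 0≤ρ (begin
      (compound s m) ^ kd
        ≈⟨ ^-congˡ kd (^-congˡ (suc m) (+-congˡ
             (solve 3 (λ S h i → S :* h :* i := h :* i :* S) refl S ((q + q) ⁻¹) (fromℕ (suc m) ⁻¹)))) ⟩
      ((1# + c * S) ^ suc m) ^ kd
        ≈⟨ ^-assocʳ (1# + c * S) (suc m) kd ⟩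
      (1# + c * S) ^ (suc m ℕ.* kd)
        ≤⟨ [1+c*sum]^N≤[1+ρ]^d A 0<lam (suc m ℕ.* kd) 0≤c 2Nc≈1 ⟩
      (1# + ρ) ^ suc d
        ≤⟨ ^-monoˡ-≤ (suc d) (+-nonNegative 0≤1 0≤ρ) 1+ρ≤ρᵏ ⟩
      (ρ ^ suc k) ^ suc d
        ≈⟨ ^-assocʳ ρ (suc k) (suc d) ⟩
      ρ ^ kd
        ∎)
      where
      -- This is `1 / 2N` for `N = (m + 1) kd`, and `c * S` equals `s / (m + 1)`, so the `N`-th
      -- power is the `kd`-th power of `compound s m`.
      c = (q + q) ⁻¹ / fromℕ (suc m)
      0≤c = /-nonNegative (x⁻¹-nonNegative 0<2q) (fromℕ-positive m)
      2Nc≈1 : fromℕ (suc m ℕ.* kd) * c + fromℕ (suc m ℕ.* kd) * c ≈ 1#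
      2Nc≈1 = begin-equality
        fromℕ (suc m ℕ.* kd) * c + fromℕ (suc m ℕ.* kd) * c
          ≈⟨ +-cong (*-congʳ (fromℕ-* (suc m) kd)) (*-congʳ (fromℕ-* (suc m) kd)) ⟩
        fromℕ (suc m) * q * c + fromℕ (suc m) * q * c
          ≈⟨ solve 3 (λ m q c → m :* q :* c :+ m :* q :* c := (q :+ q) :* (m :* c)) refl (fromℕ (suc m)) q c ⟩
        (q + q) * (fromℕ (suc m) * c)
          ≈⟨ *-congˡ (n*[y/n]≈y _ (fromℕ-positive m)) ⟩
        (q + q) * (q + q) ⁻¹
          ≈⟨ *-inverse 0<2q ⟩
        1# ∎
    s≤logρ : s ≤ log ρ
    s≤logρ = ≤-log 0≤s compound≤ρ

  -- In dimension 0 the quadratic form is an empty sum, whatever `inverse` returns.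
  sum-leverage-zero : ∀ {n} (A : Matrix n 0) lam → sum (leverage A lam) ≤ 0#
  sum-leverage-zero {n} A lam =
    ≤-trans (sum-mono-≤ {n} λ i → x⊓y≤x 0# 1#) (≤-reflexive (sum-0 {n} λ i → refl))

  module _ {κ : ℝ} (1<κ : 1# < κ) where

    κ-1>0 : 0# < κ - 1#
    κ-1>0 = ≰⇒> λ κ-1≤0 → <⇒≱ 1<κ (begin
      κ               ≈⟨ solve 1 (λ κ → κ := κ :- :1 :+ :1) refl κ ⟩
      κ - 1# + 1#     ≤⟨ +-monoˡ-≤ 1# κ-1≤0 ⟩
      0# + 1#         ≈⟨ +-identityˡ 1# ⟩
      1#              ∎)

    -- Twice `1 + k`, with `k` replaced by its upper bound `1 / (κ - 1) + 1` from `ceiling`.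
    constant : ℝ
    constant = (1# + ((κ - 1#) ⁻¹ + 1#)) + (1# + ((κ - 1#) ⁻¹ + 1#))

    constant-positive : 0# < constant
    constant-positive = +-positive (+-positive 0<1 0≤g+1) (+-nonNegative 0≤1 0≤g+1)
      where 0≤g+1 = +-nonNegative (x⁻¹-nonNegative κ-1>0) 0≤1

    -- If k ≥ 1 / (κ - 1), then ρ^k ≥ κ^k ≥ 1 + k (κ - 1) ≥ 2.
    1+ρ≤ρ^[1+k] : ∀ {ρ} k → (κ - 1#) ⁻¹ ≤ fromℕ k → κ ≤ ρ → 1# + ρ ≤ ρ ^ suc k
    1+ρ≤ρ^[1+k] {ρ} k g≤k κ≤ρ = begin
      1# + ρ                             ≤⟨ +-mono-≤ 1≤ρ ≤-refl ⟩
      ρ + ρ                              ≈⟨ solve 1 (λ ρ → ρ :+ ρ := ρ :* (:1 :+ :1)) refl ρ ⟩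
      ρ * (1# + 1#)                      ≈⟨ *-congˡ (+-congˡ (*-inverse κ-1>0)) ⟨
      ρ * (1# + (κ - 1#) * (κ - 1#) ⁻¹)  ≤⟨ *-monoˡ-≤ 0≤ρ (+-mono-≤ ≤-refl (*-monoˡ-≤ (proj₁ κ-1>0) g≤k)) ⟩
      ρ * (1# + (κ - 1#) * fromℕ k)      ≈⟨ *-congˡ (+-congˡ (*-comm _ _)) ⟩
      ρ * (1# + fromℕ k * (κ - 1#))      ≤⟨ *-monoˡ-≤ 0≤ρ (bernoulli k (proj₁ κ-1>0)) ⟩
      ρ * (1# + (κ - 1#)) ^ k            ≈⟨ *-congˡ (^-congˡ k (solve 1 (λ κ → :1 :+ (κ :- :1) := κ) refl κ)) ⟩
      ρ * κ ^ k                          ≤⟨ *-monoˡ-≤ 0≤ρ (^-monoˡ-≤ k (≤-trans 0≤1 (proj₁ 1<κ)) κ≤ρ) ⟩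
      ρ * ρ ^ k                          ∎
      where
      1≤ρ = ≤-trans (proj₁ 1<κ) κ≤ρ
      0≤ρ = ≤-trans 0≤1 1≤ρ

    sum-leverage-bound : ∀ n d (A : Matrix n d) lam → 0# < lam → κ ≤ ∥ A ∥₂ ^ 2 / lam →
      sum (leverage A lam) ≤ constant * (fromℕ d * log (∥ A ∥₂ ^ 2 / lam))
    sum-leverage-bound n zero A lam 0<lam κ≤ρ = begin
      sum (leverage A lam)                          ≤⟨ sum-leverage-zero A lam ⟩
      0#                                            ≈⟨ trans (*-congˡ (zeroˡ _)) (zeroʳ constant) ⟨
      constant * (0# * log (∥ A ∥₂ ^ 2 / lam))      ∎
    sum-leverage-bound n (suc d) A lam 0<lam κ≤ρ = stable λ ≰ →
      archimedean ((κ - 1#) ⁻¹) λ (m , g≤m) →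
        let k , g≤k , k≤g+1 = ceiling m (x⁻¹-nonNegative κ-1>0) g≤m
            0≤ρ = ≤-trans 0≤1 (≤-trans (proj₁ 1<κ) κ≤ρ)
            0≤log , bound = sum-leverage-≤ A 0<lam k 0≤ρ (1+ρ≤ρ^[1+k] k g≤k κ≤ρ)
            1+k≤ = +-mono-≤ (≤-refl {1#}) k≤g+1
        -- Enlarging the factor `2(1 + k)` to `constant` preserves the bound because the logarithm
        -- is nonnegative.
        in ≰ (≤-trans bound (*-mono-≤ (+-nonNegative (fromℕ-nonNegative (suc k)) (fromℕ-nonNegative (suc k)))
             (*-nonNegative (fromℕ-nonNegative (suc d)) 0≤log) (+-mono-≤ 1+k≤ 1+k≤) ≤-refl))

theorem2p2 : (R : CompleteOrderedField) → let open Matrices R in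
    (κ : ℝ) → 1# < κ →
    ∃[ C ] (0# < C ×
    ((n d : ℕ) (A : Matrix n d) (lam : ℝ) → 0# < lam →
    κ ≤ ∥ A ∥₂ ^ 2 / lam →
    sum (leverage A lam) ≤ C * (fromℕ d * log (∥ A ∥₂ ^ 2 / lam))))
theorem2p2 R κ 1<κ = constant 1<κ , constant-positive 1<κ , sum-leverage-bound 1<κ
  where open LeverageScores R
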